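{- Let $n\ge 1$ and consider peg solitaire on the triangular board $T_n$. Consider the problem of starting from the position in which every hole holds a peg except the hole with skew coordinates $(x_s,y_s)$, and reaching by a sequence of jumps the position in which exactly one peg remains, located at the hole $(x_f,y_f)$. A necessary condition for this problem to be solvable is: (1) if $n\equiv 1 \pmod 3$, then $x_s+y_s\not\equiv 0 \pmod 3$ and $x_s+y_s+x_f+y_f\equiv 0 \pmod 3$; or (2) if $n\not\equiv 1 \pmod 3$, then $x_s+y_s\equiv x_f+y_f \pmod 3$. Moreover, for $n\ge 6$, this condition is also sufficient: if $n\ge 6$ and the condition holds, the problem is solvable.
   Context: The triangular board $T_n$ is the set of holes with integer skew coordinates $(x,y)$ satisfying $0\le x\le y\le n-1$. A board position assigns to each hole either a peg or no peg. A jump takes a peg at hole $p$, jumps it over a peg at an adjacent hole $p+d$ into an empty hole $p+2d$, where $d$ is one of the six directions $(\pm1,0)$, $(0,\pm1)$, $(1,1)$, $(-1,-1)$ and all three holes $p,p+d,p+2d$ lie in $T_n$; the jumped-over peg at $p+d$ is removed. -}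

module Defs where

open import Data.Bool using (if_then_else_)
open import Data.Integer as ℤ using (ℤ; +_; -1ℤ; 0ℤ; 1ℤ)
open import Data.Nat using (ℕ; _+_; _≤_; _<_)
open import Data.Nat.DivMod using (_%_)
import Data.Nat.Properties as ℕ
open import Data.Product using (_×_; _,_; ∃-syntax)
open import Relation.Binary.Construct.Closure.ReflexiveTransitive using (Star)
open import Relation.Binary.Definitions using (DecidableEquality)
open import Relation.Binary.PropositionalEquality using (_≡_; _≢_; _≗_; refl)
open import Relation.Nullary using (yes; no; does)

-- The bound proofs are irrelevant, so holes with the same
-- coordinates are equal.
record Hole (n : ℕ) : Set where
  constructor hole
  field
    x y  : ℕ
    .x≤y : x ≤ y
    .y<n : y < n

open Hole public using (x; y)

_≟_ : ∀ {n} → DecidableEquality (Hole n)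
hole a b _ _ ≟ hole c d _ _ with a ℕ.≟ c | b ℕ.≟ d
... | yes refl | yes refl = yes refl
... | no a≢c   | _        = no λ { refl → a≢c refl }
... | yes _    | no b≢d   = no λ { refl → b≢d refl }

data Direction : Set where
  +x -x +y -y +xy -xy : Direction

vector : Direction → ℤ × ℤ
vector +x  = 1ℤ  , 0ℤ
vector -x  = -1ℤ , 0ℤ
vector +y  = 0ℤ  , 1ℤ
vector -y  = 0ℤ  , -1ℤ
vector +xy = 1ℤ  , 1ℤ
vector -xy = -1ℤ , -1ℤ

point : ∀ {n} → Hole n → ℤ × ℤ
point h = + x h , + y h

_⊕_ : ℤ × ℤ → ℤ × ℤ → ℤ × ℤ
(a , b) ⊕ (c , d) = a ℤ.+ c , b ℤ.+ d

data Content : Set where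
  peg empty : Content

Position : ℕ → Set
Position n = Hole n → Content

record Jump {n : ℕ} (P P′ : Position n) : Set where
  field
    d         : Direction
    p q r     : Hole n
    q≡p+d     : point q ≡ point p ⊕ vector d
    r≡p+2d    : point r ≡ (point p ⊕ vector d) ⊕ vector d
    p-before  : P p ≡ peg
    q-before  : P q ≡ peg
    r-before  : P r ≡ empty
    p-after   : P′ p ≡ empty
    q-after   : P′ q ≡ empty
    r-after   : P′ r ≡ peg
    unchanged : ∀ h → h ≢ p → h ≢ q → h ≢ r → P′ h ≡ P h

allExcept : ∀ {n} → Hole n → Position n
allExcept s h = if does (h ≟ s) then empty else peg

only : ∀ {n} → Hole n → Position n
only f h = if does (h ≟ f) then peg else empty

-- Positions are functions, so the final one is compared pointwise.
Solvable : ∀ {n} → Hole n → Hole n → Set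
Solvable s f = ∃[ P ] (Star Jump (allExcept s) P × P ≗ only f)

Condition : ∀ {n} → Hole n → Hole n → Set
Condition {n} s f =
  (n % 3 ≡ 1 → (x s + y s) % 3 ≢ 0 × (x s + y s + x f + y f) % 3 ≡ 0)
  × (n % 3 ≢ 1 → (x s + y s) % 3 ≡ (x f + y f) % 3)

{-# OPTIONS --safe #-}
module Submission where

-- Barycentric coordinates (a, b, c) with a + b + c = n − 1, where a = n − 1 − y, b = x and c = y − x,
-- turn a jump into the transfer of two units from one coordinate to another, so that translation to a
-- smaller board and rotation are immediate.
--
-- Necessity: the three holes of a jump have the three different residues of x + y mod 3, so every
-- 𝔽₂-weighting of the residues that sums to zero gives an invariant of the position.
--
-- Sufficiency: induction from T_{n−3}, the rows a ≥ 3, to T_n. After a rotation the initial vacancy lies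
-- in T_{n−3}. If the final hole f lies in the strip a ≤ 2, the complement of a game that clears the strip
-- starting from the vacancy f leads from a full strip and a single peg g of T_{n−3} to f alone, so one first
-- plays from s to g in T_{n−3}. If f lies in T_{n−3} as well, the game from s to f in T_{n−3} is interrupted
-- to clear the strip: a jump cannot empty three full holes at once, so at some moment a given triple of holes
-- next to an end of the strip is neither full nor empty, and then that end can be cleared without changing
-- the rest. The boards n = 6, 7, 8 are settled by explicit games.

open import Defs
open import Data.Bool using (Bool; true; false; not; _∧_; _∨_; _xor_; if_then_else_; T)
open import Data.Bool.Properties using (not-involutive; xor-assoc; xor-same; xor-identityʳ; ∧-distribʳ-xor)
open import Data.Integer as ℤ using (ℤ; -1ℤ; 0ℤ; 1ℤ) renaming (+_ to pos)
open import Data.Integer.Properties using () renaming (+-injective to pos-injective)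
open import Data.List using (List; []; _∷_)
open import Data.Maybe using (Maybe; just; nothing)
open import Data.Nat using (ℕ; zero; suc; _+_; _∸_; _≤_; _<_; _≥_; z≤n; s≤s; _≡ᵇ_; _<ᵇ_; _≤?_; _<?_)
open import Data.Nat.DivMod using (_%_; [m+n]%n≡m%n)
open import Data.Nat.Properties hiding (_≤?_; _<?_; _≟_)
open import Data.Nat.Tactic.RingSolver using (solve-∀)
open import Data.Product using (∃-syntax; _×_; _,_; proj₁; proj₂)
open import Data.Sum using (_⊎_; inj₁; inj₂)
open import Data.Unit using (⊤; tt)
open import Function using (_∘_)
open import Relation.Binary.Construct.Closure.ReflexiveTransitive using (Star; ε; _◅_)
open import Relation.Binary.PropositionalEquality
open import Relation.Nullary using (¬_; yes; no; does; contradiction; recompute)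

-- The induction proceeds by three rows because a line of three pegs can be removed with the help of
-- one peg and one hole beside it, both restored afterwards. Inside the strip the cleared part
-- supplies the hole and the next full line the peg, so clearing propagates from line to line. The
-- difficulty lies at the ends. A strip that is full throughout contains no hole to start from, so
-- the first hole must come from the row a = 3, and the end reached last has no further full line
-- beyond it. This is why a peg next to a hole is sought in that row. Three also suits the residues:
-- adding 3 to a keeps x + y and the residue of n, so the condition is inherited by the smaller
-- board. An explicit game is checked by evaluation on a triangle of fixed size in which some holes
-- may have unknown content. A translated copy of the triangle carries it to every larger board,
-- whatever the unknown holes contain, so finitely many computations serve all n.

-- Barycentric cells and moves.

record Cell : Set where
  constructor ⟨_,_,_⟩
  field
    a b c : ℕ

size : Cell → ℕ
size ⟨ a , b , c ⟩ = a + (b + c)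

infixl 6 _⊞_
_⊞_ : Cell → Cell → Cell
⟨ a , b , c ⟩ ⊞ ⟨ α , β , γ ⟩ = ⟨ a + α , b + β , c + γ ⟩

cell-≡ : ∀ {a a′ b b′ c c′} → a ≡ a′ → b ≡ b′ → c ≡ c′ → ⟨ a , b , c ⟩ ≡ ⟨ a′ , b′ , c′ ⟩
cell-≡ refl refl refl = refl

infix 4 _==_
_==_ : Cell → Cell → Bool
⟨ a , b , c ⟩ == ⟨ a′ , b′ , c′ ⟩ = (a ≡ᵇ a′) ∧ (b ≡ᵇ b′) ∧ (c ≡ᵇ c′)

∧-true : ∀ {u v} → u ∧ v ≡ true → u ≡ true × v ≡ true
∧-true {true} eq = refl , eq

≡ᵇ-true : ∀ {m n} → (m ≡ᵇ n) ≡ true → m ≡ n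
≡ᵇ-true {m} {n} eq = ≡ᵇ⇒≡ m n (subst T (sym eq) tt)

≡ᵇ-refl : ∀ n → (n ≡ᵇ n) ≡ true
≡ᵇ-refl zero    = refl
≡ᵇ-refl (suc n) = ≡ᵇ-refl n

==-true : ∀ {p q} → (p == q) ≡ true → p ≡ q
==-true {⟨ a , b , c ⟩} {⟨ a′ , b′ , c′ ⟩} eq
  with ea , eq′ ← ∧-true {a ≡ᵇ a′} eq
  with eb , ec ← ∧-true {b ≡ᵇ b′} eq′
  = cell-≡ (≡ᵇ-true ea) (≡ᵇ-true eb) (≡ᵇ-true ec)

==-refl : ∀ p → (p == p) ≡ true
==-refl ⟨ a , b , c ⟩ rewrite ≡ᵇ-refl a | ≡ᵇ-refl b | ≡ᵇ-refl c = refl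

≢⇒==-false : ∀ {p q} → p ≢ q → (p == q) ≡ false
≢⇒==-false {p} {q} p≢q with p == q in eq
... | true  = contradiction (==-true eq) p≢q
... | false = refl

==-false : ∀ {p q} → (p == q) ≡ false → p ≢ q
==-false {p} eq refl = contradiction (trans (sym (==-refl p)) eq) λ ()

≡ᵇ-+ : ∀ m n k → (m + k ≡ᵇ n + k) ≡ (m ≡ᵇ n)
≡ᵇ-+ m n zero    rewrite +-identityʳ m | +-identityʳ n = refl
≡ᵇ-+ m n (suc k) rewrite +-suc m k | +-suc n k = ≡ᵇ-+ m n k

==-⊞ : ∀ p q o → (p ⊞ o == q ⊞ o) ≡ (p == q)
==-⊞ ⟨ a , b , c ⟩ ⟨ a′ , b′ , c′ ⟩ ⟨ α , β , γ ⟩ =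
  cong₂ _∧_ (≡ᵇ-+ a a′ α) (cong₂ _∧_ (≡ᵇ-+ b b′ β) (≡ᵇ-+ c c′ γ))

size-⊞ : ∀ p o → size (p ⊞ o) ≡ size p + size o
size-⊞ ⟨ a , b , c ⟩ ⟨ α , β , γ ⟩ = lemma a b c α β γ
  where
  lemma : ∀ a b c α β γ → a + α + (b + β + (c + γ)) ≡ a + (b + c) + (α + (β + γ))
  lemma = solve-∀

-- A move is named after the coordinate it decreases and the one it increases,
-- and it carries the coordinates common to the three holes involved.
data Move : Set where
  ab ac ba bc ca cb : ℕ → ℕ → ℕ → Move

from over to : Move → Cell
from (ab a b c) = ⟨ 2 + a , b , c ⟩
from (ac a b c) = ⟨ 2 + a , b , c ⟩
from (ba a b c) = ⟨ a , 2 + b , c ⟩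
from (bc a b c) = ⟨ a , 2 + b , c ⟩
from (ca a b c) = ⟨ a , b , 2 + c ⟩
from (cb a b c) = ⟨ a , b , 2 + c ⟩
over (ab a b c) = ⟨ 1 + a , 1 + b , c ⟩
over (ac a b c) = ⟨ 1 + a , b , 1 + c ⟩
over (ba a b c) = ⟨ 1 + a , 1 + b , c ⟩
over (bc a b c) = ⟨ a , 1 + b , 1 + c ⟩
over (ca a b c) = ⟨ 1 + a , b , 1 + c ⟩
over (cb a b c) = ⟨ a , 1 + b , 1 + c ⟩
to (ab a b c) = ⟨ a , 2 + b , c ⟩
to (ac a b c) = ⟨ a , b , 2 + c ⟩
to (ba a b c) = ⟨ 2 + a , b , c ⟩
to (bc a b c) = ⟨ a , b , 2 + c ⟩
to (ca a b c) = ⟨ 2 + a , b , c ⟩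
to (cb a b c) = ⟨ a , 2 + b , c ⟩

size-over : ∀ m → size (over m) ≡ size (from m)
size-over (ab a b c) = cong suc (+-suc a (b + c))
size-over (ac a b c) rewrite +-suc b c | +-suc a (b + c) = refl
size-over (ba a b c) rewrite +-suc a (suc (b + c)) | +-suc a (b + c) = refl
size-over (bc a b c) rewrite +-suc b c = refl
size-over (ca a b c) rewrite +-suc b (suc c) | +-suc b c | +-suc a (suc (b + c)) = refl
size-over (cb a b c) rewrite +-suc b (suc c) = refl

size-to : ∀ m → size (to m) ≡ size (from m)
size-to (ab a b c) rewrite +-suc a (suc (b + c)) | +-suc a (b + c) = refl
size-to (ac a b c) rewrite +-suc b (suc c) | +-suc b c | +-suc a (suc (b + c)) | +-suc a (b + c) = refl
size-to (ba a b c) rewrite +-suc a (suc (b + c)) | +-suc a (b + c) = refl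
size-to (bc a b c) rewrite +-suc b (suc c) | +-suc b c = refl
size-to (ca a b c) rewrite +-suc b (suc c) | +-suc b c | +-suc a (suc (b + c)) | +-suc a (b + c) = refl
size-to (cb a b c) rewrite +-suc b (suc c) | +-suc b c = refl

shift : Cell → Move → Move
shift ⟨ α , β , γ ⟩ (ab a b c) = ab (a + α) (b + β) (c + γ)
shift ⟨ α , β , γ ⟩ (ac a b c) = ac (a + α) (b + β) (c + γ)
shift ⟨ α , β , γ ⟩ (ba a b c) = ba (a + α) (b + β) (c + γ)
shift ⟨ α , β , γ ⟩ (bc a b c) = bc (a + α) (b + β) (c + γ)
shift ⟨ α , β , γ ⟩ (ca a b c) = ca (a + α) (b + β) (c + γ)
shift ⟨ α , β , γ ⟩ (cb a b c) = cb (a + α) (b + β) (c + γ)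

from-shift : ∀ o m → from (shift o m) ≡ from m ⊞ o
from-shift o (ab _ _ _) = refl
from-shift o (ac _ _ _) = refl
from-shift o (ba _ _ _) = refl
from-shift o (bc _ _ _) = refl
from-shift o (ca _ _ _) = refl
from-shift o (cb _ _ _) = refl

over-shift : ∀ o m → over (shift o m) ≡ over m ⊞ o
over-shift o (ab _ _ _) = refl
over-shift o (ac _ _ _) = refl
over-shift o (ba _ _ _) = refl
over-shift o (bc _ _ _) = refl
over-shift o (ca _ _ _) = refl
over-shift o (cb _ _ _) = refl

to-shift : ∀ o m → to (shift o m) ≡ to m ⊞ o
to-shift o (ab _ _ _) = refl
to-shift o (ac _ _ _) = refl
to-shift o (ba _ _ _) = refl
to-shift o (bc _ _ _) = refl
to-shift o (ca _ _ _) = refl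
to-shift o (cb _ _ _) = refl

-- Positions, games and complements.

Pos : Set
Pos = Cell → Bool

_≈[_]_ : Pos → ℕ → Pos → Set
P ≈[ N ] Q = ∀ p → size p ≡ N → P p ≡ Q p

record Step (N : ℕ) (P Q : Pos) : Set where
  field
    move        : Move
    on-board    : size (from move) ≡ N
    from-before : P (from move) ≡ true
    over-before : P (over move) ≡ true
    to-before   : P (to move) ≡ false
    from-after  : Q (from move) ≡ false
    over-after  : Q (over move) ≡ false
    to-after    : Q (to move) ≡ true
    unchanged   : ∀ p → size p ≡ N → p ≢ from move → p ≢ over move → p ≢ to move → Q p ≡ P p

  over-on-board : size (over move) ≡ N
  over-on-board = trans (size-over move) on-board

  to-on-board : size (to move) ≡ N
  to-on-board = trans (size-to move) on-board

open Step

infixr 5 _then_ _⨾_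

-- Positions are functions on all cells, most of them off the board, so a game ends in a pointwise
-- comparison on the plane of size `N` instead of an equality of functions.
data Reach (N : ℕ) : Pos → Pos → Set where
  done   : ∀ {P Q} → P ≈[ N ] Q → Reach N P Q
  _then_ : ∀ {P Q R} → Step N P Q → Reach N Q R → Reach N P R

step-≈ : ∀ {N P P′ Q} → P ≈[ N ] P′ → Step N P′ Q → Step N P Q
step-≈ e s = record
  { move = move s ; on-board = on-board s
  ; from-before = trans (e _ (on-board s)) (from-before s)
  ; over-before = trans (e _ (over-on-board s)) (over-before s)
  ; to-before = trans (e _ (to-on-board s)) (to-before s)
  ; from-after = from-after s ; over-after = over-after s ; to-after = to-after s
  ; unchanged = λ p h u v w → trans (unchanged s p h u v w) (sym (e p h)) }

≈-reach : ∀ {N P P′ Q} → P ≈[ N ] P′ → Reach N P′ Q → Reach N P Q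
≈-reach e (done e′)  = done λ p h → trans (e p h) (e′ p h)
≈-reach e (s then r) = step-≈ e s then r

_⨾_ : ∀ {N P Q R} → Reach N P Q → Reach N Q R → Reach N P R
done e ⨾ r′     = ≈-reach e r′
(s then r) ⨾ r′ = s then (r ⨾ r′)

-- Complementing a position turns a jump into the reverse of a jump with the same three holes.
dual : ∀ {N P Q} → Reach N P Q → Reach N (not ∘ Q) (not ∘ P)
dual (done e)   = done λ p h → cong not (sym (e p h))
dual {N} (_then_ {P} {Q} s r) = dual r ⨾ step then done (λ _ _ → refl)
  where
  step : Step N (not ∘ Q) (not ∘ P)
  step = record
    { move = move s ; on-board = on-board s
    ; from-before = cong not (from-after s)
    ; over-before = cong not (over-after s)
    ; to-before = cong not (to-after s)
    ; from-after = cong not (from-before s)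
    ; over-after = cong not (over-before s)
    ; to-after = cong not (to-before s)
    ; unchanged = λ p h u v w → cong not (sym (unchanged s p h u v w)) }

-- Rotation of the board.

rot : Cell → Cell
rot ⟨ a , b , c ⟩ = ⟨ b , c , a ⟩

rot⁻¹ : Cell → Cell
rot⁻¹ ⟨ a , b , c ⟩ = ⟨ c , a , b ⟩

size-rot : ∀ p → size (rot p) ≡ size p
size-rot ⟨ a , b , c ⟩ = trans (sym (+-assoc b c a)) (+-comm (b + c) a)

-- Positions are rotated by precomposition with `rot`, so moves are pulled back: this is the
-- preimage of the given move.
rotMove : Move → Move
rotMove (ab a b c) = bc c a b
rotMove (ac a b c) = ba c a b
rotMove (ba a b c) = cb c a b
rotMove (bc a b c) = ca c a b
rotMove (ca a b c) = ab c a b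
rotMove (cb a b c) = ac c a b

rot-from : ∀ m → rot (from (rotMove m)) ≡ from m
rot-from (ab _ _ _) = refl
rot-from (ac _ _ _) = refl
rot-from (ba _ _ _) = refl
rot-from (bc _ _ _) = refl
rot-from (ca _ _ _) = refl
rot-from (cb _ _ _) = refl

rot-over : ∀ m → rot (over (rotMove m)) ≡ over m
rot-over (ab _ _ _) = refl
rot-over (ac _ _ _) = refl
rot-over (ba _ _ _) = refl
rot-over (bc _ _ _) = refl
rot-over (ca _ _ _) = refl
rot-over (cb _ _ _) = refl

rot-to : ∀ m → rot (to (rotMove m)) ≡ to m
rot-to (ab _ _ _) = refl
rot-to (ac _ _ _) = refl
rot-to (ba _ _ _) = refl
rot-to (bc _ _ _) = refl
rot-to (ca _ _ _) = refl
rot-to (cb _ _ _) = refl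

rotate : ∀ {N P Q} → Reach N P Q → Reach N (P ∘ rot) (Q ∘ rot)
rotate (done e) = done λ p h → e (rot p) (trans (size-rot p) h)
rotate {N} (_then_ {P} {Q} s r) = step then rotate r
  where
  m = move s
  ≢rot : ∀ {p q q′} → rot q ≡ q′ → p ≢ q → rot p ≢ q′
  ≢rot e p≢q e′ = p≢q (cong rot⁻¹ (trans e′ (sym e)))
  step : Step N (P ∘ rot) (Q ∘ rot)
  step = record
    { move = rotMove m
    ; on-board = trans (sym (size-rot (from (rotMove m)))) (trans (cong size (rot-from m)) (on-board s))
    ; from-before = trans (cong P (rot-from m)) (from-before s)
    ; over-before = trans (cong P (rot-over m)) (over-before s)
    ; to-before = trans (cong P (rot-to m)) (to-before s)
    ; from-after = trans (cong Q (rot-from m)) (from-after s)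
    ; over-after = trans (cong Q (rot-over m)) (over-after s)
    ; to-after = trans (cong Q (rot-to m)) (to-after s)
    ; unchanged = λ p h u v w → unchanged s (rot p) (trans (size-rot p) h)
        (≢rot (rot-from m) u) (≢rot (rot-over m) v) (≢rot (rot-to m) w) }

allBut only₁ : Cell → Pos
allBut s p = not (p == s)
only₁ f p = p == f

Solv : ℕ → Cell → Cell → Set
Solv N s f = Reach N (allBut s) (only₁ f)

-- Complementation exchanges a single vacancy with a single peg.
solv-dual : ∀ {N s f} → Solv N s f → Solv N f s
solv-dual r = dual r ⨾ done λ p _ → not-involutive _

==-rot : ∀ p q → (rot p == rot q) ≡ (p == q)
==-rot ⟨ a , b , c ⟩ ⟨ a′ , b′ , c′ ⟩ with a ≡ᵇ a′ | b ≡ᵇ b′ | c ≡ᵇ c′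
... | true  | true  | true  = refl
... | true  | true  | false = refl
... | true  | false | _     = refl
... | false | true  | true  = refl
... | false | true  | false = refl
... | false | false | _     = refl

solv-rot : ∀ {N s f} → Solv N (rot s) (rot f) → Solv N s f
solv-rot {s = s} {f} r =
  ≈-reach (λ p _ → cong not (sym (==-rot p s))) (rotate r ⨾ done λ p _ → ==-rot p f)

-- Checking explicit games by evaluation.

allSum : ℕ → (ℕ → ℕ → Bool) → Bool
allSum zero    f = f 0 0
allSum (suc K) f = f 0 (suc K) ∧ allSum K λ i j → f (suc i) j

allPlane : ℕ → (Cell → Bool) → Bool
allPlane K f = allSum K λ a m → allSum m λ b c → f ⟨ a , b , c ⟩

allSum-sound : ∀ K f → allSum K f ≡ true → ∀ i j → i + j ≡ K → f i j ≡ true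
allSum-sound zero f eq zero .zero refl = eq
allSum-sound (suc K) f eq zero .(suc K) refl = proj₁ (∧-true eq)
allSum-sound (suc K) f eq (suc i) j h =
  allSum-sound K (λ i j → f (suc i) j) (proj₂ (∧-true {f 0 (suc K)} eq)) i j (suc-injective h)

allPlane-sound : ∀ K f → allPlane K f ≡ true → ∀ p → size p ≡ K → f p ≡ true
allPlane-sound K f eq ⟨ a , b , c ⟩ h =
  allSum-sound (b + c) (λ b c → f ⟨ a , b , c ⟩) (allSum-sound K _ eq a (b + c) h) b c refl

-- nothing: the content of the hole is unknown, and no move may touch it.
Pattern : Set
Pattern = Cell → Maybe Bool

is : Bool → Maybe Bool → Bool
is true  (just u) = u
is false (just u) = not u
is _     nothing  = false

same : Maybe Bool → Maybe Bool → Bool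
same (just u) v       = is u v
same nothing  nothing  = true
same nothing  (just _) = false

legal : Move → Pattern → Bool
legal m L = is true (L (from m)) ∧ is true (L (over m)) ∧ is false (L (to m))

jump : Move → Pos → Pos
jump m P p = if p == from m then false else if p == over m then false else if p == to m then true else P p

play : Move → Pattern → Pattern
play m L p = if p == from m then just false else if p == over m then just false else if p == to m then just true else L p

playable : ℕ → List Move → Pattern → Bool
playable K []       L = true
playable K (m ∷ ms) L = (size (from m) ≡ᵇ K) ∧ legal m L ∧ playable K ms (play m L)

plays : List Move → Pattern → Pattern
plays []       L = L
plays (m ∷ ms) L = plays ms (play m L)

-- The final pattern has to match exactly, including the places still unknown, so that unknown at
-- the end can be read as untouched.
leads : ℕ → List Move → Pattern → Pattern → Bool
leads K ms L L′ = playable K ms L ∧ allPlane K λ p → same (plays ms L p) (L′ p)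

is-sound : ∀ u {v} → is u v ≡ true → v ≡ just u
is-sound true  {just true}  _ = refl
is-sound false {just false} _ = refl

same-sound : ∀ u {v} → same u v ≡ true → u ≡ v
same-sound (just u) eq = sym (is-sound u eq)
same-sound nothing {nothing} _ = refl

Fit : Maybe Bool → Bool → Set
Fit (just u) v = v ≡ u
Fit nothing  v = ⊤

-- An unknown entry of a final pattern does not mean arbitrary content: the old content is kept.
Upd : Maybe Bool → Bool → Bool → Set
Upd (just u) v v′ = v′ ≡ u
Upd nothing  v v′ = v′ ≡ v

data Outside : Cell → Cell → Set where
  below-a : ∀ {a b c α β γ} → a < α → Outside ⟨ α , β , γ ⟩ ⟨ a , b , c ⟩
  below-b : ∀ {a b c α β γ} → b < β → Outside ⟨ α , β , γ ⟩ ⟨ a , b , c ⟩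
  below-c : ∀ {a b c α β γ} → c < γ → Outside ⟨ α , β , γ ⟩ ⟨ a , b , c ⟩

outside-≢ : ∀ {o p} → Outside o p → ∀ d → p ≢ d ⊞ o
outside-≢ (below-a h) d refl = <⇒≱ h (m≤n+m _ _)
outside-≢ (below-b h) d refl = <⇒≱ h (m≤n+m _ _)
outside-≢ (below-c h) d refl = <⇒≱ h (m≤n+m _ _)

inside? : ∀ o p → (∃[ d ] p ≡ d ⊞ o) ⊎ Outside o p
inside? ⟨ α , β , γ ⟩ ⟨ a , b , c ⟩ with α ≤? a | β ≤? b | γ ≤? c
... | yes u | yes v | yes w = inj₁ (⟨ a ∸ α , b ∸ β , c ∸ γ ⟩ ,
        sym (cell-≡ (m∸n+n≡m u) (m∸n+n≡m v) (m∸n+n≡m w)))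
... | no u  | _     | _     = inj₂ (below-a (≰⇒> u))
... | yes _ | no v  | _     = inj₂ (below-b (≰⇒> v))
... | yes _ | yes _ | no w  = inj₂ (below-c (≰⇒> w))

from≢over : ∀ m → (over m == from m) ≡ false
from≢over m = ≢⇒==-false (neq m)
  where
  neq : ∀ m → over m ≢ from m
  neq (ab _ _ _) ()
  neq (ac _ _ _) ()
  neq (ba _ _ _) ()
  neq (bc _ _ _) ()
  neq (ca _ _ _) ()
  neq (cb _ _ _) ()

from≢to : ∀ m → (to m == from m) ≡ false
from≢to m = ≢⇒==-false (neq m)
  where
  neq : ∀ m → to m ≢ from m
  neq (ab _ _ _) ()
  neq (ac _ _ _) ()
  neq (ba _ _ _) ()
  neq (bc _ _ _) ()
  neq (ca _ _ _) ()
  neq (cb _ _ _) ()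

over≢to : ∀ m → (to m == over m) ≡ false
over≢to m = ≢⇒==-false (neq m)
  where
  neq : ∀ m → to m ≢ over m
  neq (ab _ _ _) ()
  neq (ac _ _ _) ()
  neq (ba _ _ _) ()
  neq (bc _ _ _) ()
  neq (ca _ _ _) ()
  neq (cb _ _ _) ()

jump-step : ∀ {N P} m → size (from m) ≡ N →
            P (from m) ≡ true → P (over m) ≡ true → P (to m) ≡ false → Step N P (jump m P)
jump-step {N} {P} m h u v w = record
  { move = m ; on-board = h ; from-before = u ; over-before = v ; to-before = w
  ; from-after = fa ; over-after = oa ; to-after = ta ; unchanged = un }
  where
  fa : jump m P (from m) ≡ false
  fa rewrite ==-refl (from m) = refl
  oa : jump m P (over m) ≡ false
  oa rewrite from≢over m | ==-refl (over m) = refl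
  ta : jump m P (to m) ≡ true
  ta rewrite from≢to m | over≢to m | ==-refl (to m) = refl
  un : ∀ p → size p ≡ N → p ≢ from m → p ≢ over m → p ≢ to m → jump m P p ≡ P p
  un p _ x y z rewrite ≢⇒==-false x | ≢⇒==-false y | ≢⇒==-false z = refl

play-nothing : ∀ m L d → play m L d ≡ nothing → L d ≡ nothing
play-nothing m L d eq with d == from m | d == over m | d == to m
... | false | false | false = eq
play-nothing m L d () | true | _ | _
play-nothing m L d () | false | true | _
play-nothing m L d () | false | false | true

-- A hole touched by a move becomes known and remains known.
plays-nothing : ∀ ms L d → plays ms L d ≡ nothing → L d ≡ nothing
plays-nothing []       L d eq = eq
plays-nothing (m ∷ ms) L d eq = play-nothing m L d (plays-nothing ms (play m L) d eq)

-- Translating a checked game into a larger board.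

module Window (K N : ℕ) (o : Cell) (size-o : K + size o ≡ N) where

  Fits : Pattern → Pos → Set
  Fits L P = ∀ d → size d ≡ K → Fit (L d) (P (d ⊞ o))

  jump-⊞ : ∀ m P d → jump (shift o m) P (d ⊞ o)
         ≡ (if d == from m then false else if d == over m then false else if d == to m then true else P (d ⊞ o))
  jump-⊞ m P d rewrite from-shift o m | over-shift o m | to-shift o m
    | ==-⊞ d (from m) o | ==-⊞ d (over m) o | ==-⊞ d (to m) o = refl

  jump-fits : ∀ {L P} m → Fits L P → Fits (play m L) (jump (shift o m) P)
  jump-fits {L} {P} m fits d h rewrite jump-⊞ m P d with d == from m | d == over m | d == to m
  ... | true  | _     | _     = refl
  ... | false | true  | _     = refl
  ... | false | false | true  = refl
  ... | false | false | false = fits d h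

  jump-unknown : ∀ L P m d → play m L d ≡ nothing → jump (shift o m) P (d ⊞ o) ≡ P (d ⊞ o)
  jump-unknown L P m d eq rewrite jump-⊞ m P d with d == from m | d == over m | d == to m
  ... | false | false | false = refl
  jump-unknown L P m d () | true | _ | _
  jump-unknown L P m d () | false | true | _
  jump-unknown L P m d () | false | false | true

  jump-outside : ∀ P m p → Outside o p → jump (shift o m) P p ≡ P p
  jump-outside P m p out rewrite from-shift o m | over-shift o m | to-shift o m
    | ≢⇒==-false (outside-≢ out (from m)) | ≢⇒==-false (outside-≢ out (over m))
    | ≢⇒==-false (outside-≢ out (to m)) = refl

  Result : List Move → Pattern → Pos → Pos → Set
  Result ms L P P₁ = Reach N P P₁
    × (∀ d → size d ≡ K → Upd (plays ms L d) (P (d ⊞ o)) (P₁ (d ⊞ o)))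
    × (∀ p → Outside o p → P₁ p ≡ P p)

  size-shift : ∀ {d} → size d ≡ K → size (d ⊞ o) ≡ N
  size-shift {d} h = trans (size-⊞ d o) (trans (cong (_+ size o) h) size-o)

  run : ∀ ms {L P} → playable K ms L ≡ true → Fits L P → ∃[ P₁ ] Result ms L P P₁
  run [] {L} {P} _ fits = P , done (λ _ _ → refl) , same-value , λ _ _ → refl
    where
    same-value : ∀ d → size d ≡ K → Upd (L d) (P (d ⊞ o)) (P (d ⊞ o))
    same-value d h with L d | fits d h
    ... | just u  | e = e
    ... | nothing | _ = refl
  run (m ∷ ms) {L} {P} ok fits
    with hs , ok′ ← ∧-true {size (from m) ≡ᵇ K} ok
    with hl , ok″ ← ∧-true {legal m L} ok′
    with hf , hl′ ← ∧-true {is true (L (from m))} hl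
    with ho , ht ← ∧-true {is true (L (over m))} hl′
    with P₁ , r , up , out ← run ms {play m L} {jump (shift o m) P} ok″ (jump-fits {L} {P} m fits)
    = P₁ , step then r , up′ , λ p h → trans (out p h) (jump-outside P m p h)
    where
    on : size (from m) ≡ K
    on = ≡ᵇ-true {size (from m)} hs
    value : ∀ d u → is u (L d) ≡ true → size d ≡ K → P (d ⊞ o) ≡ u
    value d u e h = subst (λ v → Fit v (P (d ⊞ o))) (is-sound u e) (fits d h)
    step : Step N P (jump (shift o m) P)
    step = jump-step (shift o m)
      (trans (cong size (from-shift o m)) (size-shift {from m} on))
      (trans (cong P (from-shift o m)) (value (from m) true hf on))
      (trans (cong P (over-shift o m)) (value (over m) true ho (trans (size-over m) on)))
      (trans (cong P (to-shift o m)) (value (to m) false ht (trans (size-to m) on)))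
    up′ : ∀ d → size d ≡ K → Upd (plays ms (play m L) d) (P (d ⊞ o)) (P₁ (d ⊞ o))
    up′ d h with plays ms (play m L) d in eq | up d h
    ... | just u  | e = e
    ... | nothing | e = trans e (jump-unknown L P m d (plays-nothing ms (play m L) d eq))

  -- `run` yields some final position. Inside the window both it and `P′` are determined by `L′` and
  -- `P`, and outside both agree with `P`, so the two coincide on the board.
  window : ∀ ms {L L′ P P′} → leads K ms L L′ ≡ true → Fits L P →
           (∀ d → size d ≡ K → Upd (L′ d) (P (d ⊞ o)) (P′ (d ⊞ o))) →
           (∀ p → size p ≡ N → Outside o p → P′ p ≡ P p) → Reach N P P′
  window ms {L} {L′} {P} {P′} ok fits up′ out′
    with hp , hs ← ∧-true {playable K ms L} ok
    with P₁ , r , up , out ← run ms hp fits = r ⨾ done agree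
    where
    unique : ∀ {v v₁ v₂} u → Upd u v v₁ → Upd u v v₂ → v₁ ≡ v₂
    unique (just _) e e′ = trans e (sym e′)
    unique nothing  e e′ = trans e (sym e′)
    agree : P₁ ≈[ N ] P′
    agree p h with inside? o p
    ... | inj₂ x = trans (out p x) (sym (out′ p h x))
    ... | inj₁ (d , refl) = unique (L′ d)
            (subst (λ u → Upd u (P (d ⊞ o)) (P₁ (d ⊞ o))) (same-sound _ (allPlane-sound K _ hs d hd)) (up d hd))
            (up′ d hd)
      where
      hd : size d ≡ K
      hd = +-cancelʳ-≡ (size o) (size d) K (trans (sym (size-⊞ d o)) (trans h (sym size-o)))

⊞-zero : ∀ p → p ⊞ ⟨ 0 , 0 , 0 ⟩ ≡ p
⊞-zero ⟨ a , b , c ⟩ = cell-≡ (+-identityʳ a) (+-identityʳ b) (+-identityʳ c)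

run-board : ∀ K ms {P P′} → leads K ms (just ∘ P) (just ∘ P′) ≡ true → Reach K P P′
run-board K ms {P} {P′} ok =
  Window.window K K ⟨ 0 , 0 , 0 ⟩ (+-identityʳ K) ms ok
    (λ d _ → cong P (⊞-zero d)) (λ d _ → cong P′ (⊞-zero d)) λ { p _ (below-a ()) ; p _ (below-b ()) ; p _ (below-c ()) }

-- The strip of three rows and sweeps through its middle.

-- Rows a ≤ 2 form the strip; its contents depend on b only.
strip : ∀ {A : Set} → (ℕ → A) → (Cell → A) → Cell → A
strip τ Q ⟨ 0 , b , c ⟩ = τ b
strip τ Q ⟨ 1 , b , c ⟩ = τ b
strip τ Q ⟨ 2 , b , c ⟩ = τ b
strip τ Q ⟨ suc (suc (suc a)) , b , c ⟩ = Q ⟨ a , b , c ⟩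

bottom : (ℕ → Maybe Bool) → Pattern
bottom row ⟨ zero , b , c ⟩ = row b
bottom row ⟨ suc _ , b , c ⟩ = nothing

beyond-window : ∀ {K β γ b c} a → a ≤ 2 → c < γ → a + (b + c) ≡ suc K + (β + γ) → K + β ≤ b
beyond-window {K} {β} {γ} {b} {c} a a≤2 c<γ h = ≤-pred (+-cancelʳ-≤ γ (suc K + β) (suc b) (begin
  suc K + β + γ   ≡⟨ trans (+-assoc (suc K) β γ) (sym h) ⟩
  a + (b + c)     ≤⟨ +-mono-≤ a≤2 ≤-refl ⟩
  2 + (b + c)     ≡⟨ cong suc (sym (+-suc b c)) ⟩
  suc b + suc c   ≤⟨ +-mono-≤ (≤-refl {suc b}) c<γ ⟩
  suc b + γ       ∎))
  where open ≤-Reasoning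

-- The row next to the strip is a catalyst: `row` occurs in both patterns, so its holes recover
-- their contents. The last hypothesis concerns lines only partly in the window. Those from `K` on
-- protrude to its right unless the window touches the right edge of the board, and a line must
-- change as a whole or not at all.
strip-window : ∀ K {N} ms pre post row →
  leads (suc K) ms (strip pre (bottom row)) (strip post (bottom row)) ≡ true →
  ∀ β γ {τ τ′ Q} → suc K + (β + γ) ≡ N →
  (∀ k → Fit (pre k) (τ (k + β))) →
  (∀ k → Upd (post k) (τ (k + β)) (τ′ (k + β))) →
  (∀ b → b < β → τ′ b ≡ τ b) →
  (∀ b c → 2 + (b + c) ≡ K → Fit (row b) (Q ⟨ 0 , b + β , c + γ ⟩)) →
  γ ≡ 0 ⊎ (∀ k → K ≤ k → post k ≡ nothing) →
  Reach N (strip τ Q) (strip τ′ Q)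
strip-window K {N} ms pre post row ok β γ {τ} {τ′} {Q} hN hpre hpost hlow hrow hγ =
  window ms {strip pre (bottom row)} {strip post (bottom row)} ok fits ups out
  where
  open Window (suc K) N ⟨ 0 , β , γ ⟩ hN
  fits : Fits (strip pre (bottom row)) (strip τ Q)
  fits ⟨ 0 , b , c ⟩ h = hpre b
  fits ⟨ 1 , b , c ⟩ h = hpre b
  fits ⟨ 2 , b , c ⟩ h = hpre b
  fits ⟨ suc (suc (suc zero)) , b , c ⟩ h = hrow b c (suc-injective h)
  fits ⟨ suc (suc (suc (suc a))) , b , c ⟩ h = tt
  known : ∀ {v} u → Fit u v → Upd u v v
  known (just _) e = e
  known nothing  _ = refl
  ups : ∀ d → size d ≡ suc K → Upd (strip post (bottom row) d)
          (strip τ Q (d ⊞ ⟨ 0 , β , γ ⟩)) (strip τ′ Q (d ⊞ ⟨ 0 , β , γ ⟩))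
  ups ⟨ 0 , b , c ⟩ h = hpost b
  ups ⟨ 1 , b , c ⟩ h = hpost b
  ups ⟨ 2 , b , c ⟩ h = hpost b
  ups ⟨ suc (suc (suc zero)) , b , c ⟩ h = known (row b) (hrow b c (suc-injective h))
  ups ⟨ suc (suc (suc (suc a))) , b , c ⟩ h = refl
  right : ∀ a {b c} → a ≤ 2 → c < γ → a + (b + c) ≡ N →
          γ ≡ 0 ⊎ (∀ k → K ≤ k → post k ≡ nothing) → τ′ b ≡ τ b
  right a a≤2 () h (inj₁ refl)
  right a {b} {c} a≤2 c<γ h (inj₂ post-nothing) = subst (λ i → τ′ i ≡ τ i) b′+β≡b
    (subst (λ u → Upd u (τ (b′ + β)) (τ′ (b′ + β))) (post-nothing b′ K≤b′) (hpost b′))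
    where
    b′ = b ∸ β
    bound : K + β ≤ b
    bound = beyond-window {K} {β} a a≤2 c<γ (trans h (sym hN))
    b′+β≡b : b′ + β ≡ b
    b′+β≡b = m∸n+n≡m (≤-trans (m≤n+m β K) bound)
    K≤b′ : K ≤ b′
    K≤b′ = +-cancelʳ-≤ β K b′ (≤-trans bound (≤-reflexive (sym b′+β≡b)))
  out : ∀ p → size p ≡ N → Outside ⟨ 0 , β , γ ⟩ p → strip τ′ Q p ≡ strip τ Q p
  out ⟨ suc (suc (suc a)) , b , c ⟩ h o = refl
  out ⟨ 0 , b , c ⟩ h (below-b b<β) = hlow b b<β
  out ⟨ 1 , b , c ⟩ h (below-b b<β) = hlow b b<β
  out ⟨ 2 , b , c ⟩ h (below-b b<β) = hlow b b<β
  out ⟨ 0 , b , c ⟩ h (below-c c<γ) = right 0 z≤n c<γ h hγ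
  out ⟨ 1 , b , c ⟩ h (below-c c<γ) = right 1 (s≤s z≤n) c<γ h hγ
  out ⟨ 2 , b , c ⟩ h (below-c c<γ) = right 2 (s≤s (s≤s z≤n)) c<γ h hγ

gap : ℕ → ℕ → ℕ → Bool
gap i j b = (b <ᵇ i) ∨ not (b <ᵇ j)

<⇒<ᵇ-true : ∀ {m n} → m < n → (m <ᵇ n) ≡ true
<⇒<ᵇ-true {zero}  (s≤s _) = refl
<⇒<ᵇ-true {suc m} (s≤s h) = <⇒<ᵇ-true h

≥⇒<ᵇ-false : ∀ {m n} → n ≤ m → (m <ᵇ n) ≡ false
≥⇒<ᵇ-false z≤n     = refl
≥⇒<ᵇ-false (s≤s h) = ≥⇒<ᵇ-false h

gap-left : ∀ {i} j {b} → b < i → gap i j b ≡ true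
gap-left j h rewrite <⇒<ᵇ-true h = refl

gap-inside : ∀ {i j b} → i ≤ b → b < j → gap i j b ≡ false
gap-inside h h′ rewrite ≥⇒<ᵇ-false h | <⇒<ᵇ-true h′ = refl

gap-right : ∀ {i j b} → j ≤ b → gap i j b ≡ true
gap-right {i} {b = b} h rewrite ≥⇒<ᵇ-false h with b <ᵇ i
... | true  = refl
... | false = refl

strip-≈ : ∀ {N} {τ τ′ : ℕ → Bool} {Q} → (∀ b → b ≤ N → τ b ≡ τ′ b) → strip τ Q ≈[ N ] strip τ′ Q
strip-≈ e ⟨ 0 , b , c ⟩ refl = e b (m≤m+n b c)
strip-≈ e ⟨ 1 , b , c ⟩ refl = e b (m≤n⇒m≤1+n (m≤m+n b c))
strip-≈ e ⟨ 2 , b , c ⟩ refl = e b (m≤n⇒m≤1+n (m≤n⇒m≤1+n (m≤m+n b c)))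
strip-≈ e ⟨ suc (suc (suc a)) , b , c ⟩ h = refl

unknown : ℕ → Maybe Bool
unknown _ = nothing

-- The three pegs of a line b = const are removed by letting a peg at one of the two neighbours of
-- its top hole jump over that hole and, after the lower two pegs have been reduced to the top one, back.
sweepˡ : ∀ β γ {j Q} → 3 + β ≤ j → Reach (4 + (β + γ)) (strip (gap (2 + β) j) Q) (strip (gap (1 + β) j) Q)
sweepˡ β γ {j} hj = strip-window 3 (cb 2 0 0 ∷ ca 0 1 1 ∷ bc 2 0 0 ∷ []) pre post unknown refl β γ refl
  hpre hpost (λ b h → trans (gap-left j (m≤n⇒m≤1+n h)) (sym (gap-left j (m≤n⇒m≤1+n (m≤n⇒m≤1+n h)))))
  (λ _ _ _ → tt) (inj₂ λ { _ (s≤s (s≤s (s≤s z≤n))) → refl })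
  where
  pre post : ℕ → Maybe Bool
  pre 0 = just true
  pre 1 = just true
  pre 2 = just false
  pre _ = nothing
  post 0 = just true
  post 1 = just false
  post 2 = just false
  post _ = nothing
  hpre : ∀ k → Fit (pre k) (gap (2 + β) j (k + β))
  hpre 0 = gap-left j (m≤n⇒m≤1+n (n<1+n β))
  hpre 1 = gap-left j ≤-refl
  hpre 2 = gap-inside ≤-refl hj
  hpre (suc (suc (suc k))) = tt
  hpost : ∀ k → Upd (post k) (gap (2 + β) j (k + β)) (gap (1 + β) j (k + β))
  hpost 0 = gap-left j (n<1+n β)
  hpost 1 = gap-inside ≤-refl (<⇒≤ hj)
  hpost 2 = gap-inside (n≤1+n _) hj
  hpost (suc (suc (suc k)))
    rewrite ≥⇒<ᵇ-false {2 + k + β} {β} (m≤n+m β (2 + k)) | ≥⇒<ᵇ-false {1 + k + β} {β} (m≤n+m β (1 + k)) = refl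

-- Mirror image of `sweepˡ`: the hole is on line `β`, and the peg that jumps over and back comes
-- from line `2 + β`.
sweepʳ : ∀ β γ {i Q} → i ≤ β → Reach (4 + (β + γ)) (strip (gap i (1 + β)) Q) (strip (gap i (2 + β)) Q)
sweepʳ β γ {i} hi = strip-window 3 (bc 2 0 0 ∷ ca 0 1 1 ∷ cb 2 0 0 ∷ []) pre post unknown refl β γ refl
  hpre hpost low
  (λ _ _ _ → tt) (inj₂ λ { _ (s≤s (s≤s (s≤s z≤n))) → refl })
  where
  pre post : ℕ → Maybe Bool
  pre 0 = just false
  pre 1 = just true
  pre 2 = just true
  pre _ = nothing
  post 0 = just false
  post 1 = just false
  post 2 = just true
  post _ = nothing
  hpre : ∀ k → Fit (pre k) (gap i (1 + β) (k + β))
  hpre 0 = gap-inside hi ≤-refl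
  hpre 1 = gap-right {i} ≤-refl
  hpre 2 = gap-right {i} (n≤1+n _)
  hpre (suc (suc (suc k))) = tt
  hpost : ∀ k → Upd (post k) (gap i (1 + β) (k + β)) (gap i (2 + β) (k + β))
  hpost 0 = gap-inside hi (n≤1+n _)
  hpost 1 = gap-inside (m≤n⇒m≤1+n hi) ≤-refl
  hpost 2 = gap-right {i} ≤-refl
  hpost (suc (suc (suc k))) = trans (gap-right {i} (s≤s (s≤s (m≤n+m β (1 + k)))))
                                (sym (gap-right {i} (s≤s (m≤n+m β (2 + k)))))
  low : ∀ b → b < β → gap i (2 + β) b ≡ gap i (1 + β) b
  low b h rewrite <⇒<ᵇ-true {b} {1 + β} (m≤n⇒m≤1+n h) | <⇒<ᵇ-true {b} {2 + β} (m≤n⇒m≤1+n (m≤n⇒m≤1+n h)) = refl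

-- The bound on `j` provides an empty line beside the next full one, without which no sweep can
-- start; the bound on `N` keeps the small window on the board.
sweepsˡ : ∀ m k {N j Q} → 3 + (m + k) ≤ N → 2 + (m + k) ≤ j →
          Reach N (strip (gap (1 + (m + k)) j) Q) (strip (gap (1 + k) j) Q)
sweepsˡ zero    k hN hj = done λ _ _ → refl
sweepsˡ (suc m) k hN hj with γ , refl ← m≤n⇒∃[o]m+o≡n hN =
  sweepˡ (m + k) γ hj ⨾ sweepsˡ m k (≤-trans (n≤1+n _) hN) (≤-trans (n≤1+n _) hj)

sweepsʳ : ∀ m k {N Q} → 3 + (m + k) ≤ N →
          Reach N (strip (gap 0 (1 + k)) Q) (strip (gap 0 (1 + (m + k))) Q)
sweepsʳ zero    k hN = done λ _ _ → refl
sweepsʳ (suc m) k hN with γ , refl ← m≤n⇒∃[o]m+o≡n hN =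
  sweepsʳ m k (≤-trans (n≤1+n _) hN) ⨾ sweepʳ (m + k) γ z≤n

-- Clearing the two ends of the strip.

leftMoves₁ leftMoves₂ : Bool → List Move
leftMoves₁ true =
  ba 1 1 4 ∷ cb 2 0 4 ∷ bc 2 1 3 ∷ cb 1 1 4 ∷ ab 1 0 5 ∷ bc 1 1 4 ∷ ca 0 1 5 ∷ bc 0 1 5 ∷ cb 0 0 6 ∷
  ac 1 1 4 ∷ ba 0 0 6 ∷ ca 1 0 5 ∷ []
leftMoves₁ false =
  ba 1 0 5 ∷ bc 2 1 3 ∷ cb 2 0 4 ∷ cb 1 0 5 ∷ bc 1 1 4 ∷ ab 1 1 4 ∷ ca 0 1 5 ∷ bc 0 1 5 ∷ cb 0 0 6 ∷
  ab 1 0 5 ∷ ca 0 2 4 ∷ ba 1 1 4 ∷ []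
leftMoves₂ true =
  ca 1 2 3 ∷ cb 2 0 4 ∷ bc 2 1 3 ∷ cb 1 0 5 ∷ ac 1 1 4 ∷ ba 0 0 6 ∷ cb 0 0 6 ∷ ca 0 2 4 ∷ ac 1 2 3 ∷
  ba 0 1 5 ∷ cb 2 0 4 ∷ ba 1 1 4 ∷ []
leftMoves₂ false =
  ba 1 1 4 ∷ cb 2 0 4 ∷ bc 2 1 3 ∷ ba 0 0 6 ∷ cb 2 0 4 ∷ ba 0 1 5 ∷ ac 1 1 4 ∷ ca 0 1 5 ∷ ca 0 0 6 ∷
  ac 1 2 3 ∷ cb 2 0 4 ∷ ca 1 2 3 ∷ []

rightMoves₁ rightMoves₂ : Bool → List Move
rightMoves₁ true =
  ca 1 4 1 ∷ bc 2 4 0 ∷ ac 1 4 1 ∷ ba 0 4 2 ∷ ab 1 3 2 ∷ cb 0 4 2 ∷ ba 0 6 0 ∷ bc 0 5 1 ∷ ac 0 6 0 ∷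
  bc 0 4 2 ∷ ca 0 4 2 ∷ ba 1 3 2 ∷ []
rightMoves₁ false =
  ba 1 3 2 ∷ bc 2 4 0 ∷ ab 1 3 2 ∷ ca 0 4 2 ∷ ac 1 4 1 ∷ bc 0 4 2 ∷ ba 0 6 0 ∷ ac 0 6 0 ∷ bc 0 5 1 ∷
  cb 0 4 2 ∷ ba 0 4 2 ∷ ca 1 4 1 ∷ []
rightMoves₂ true =
  ba 1 5 0 ∷ cb 2 4 0 ∷ ab 1 5 0 ∷ ca 0 4 2 ∷ ac 1 4 1 ∷ bc 0 4 2 ∷ ba 0 6 0 ∷ ac 0 6 0 ∷ bc 0 5 1 ∷
  cb 0 4 2 ∷ ba 0 4 2 ∷ ca 1 4 1 ∷ []
rightMoves₂ false =
  ca 1 4 1 ∷ bc 2 4 0 ∷ ac 1 4 1 ∷ ba 0 4 2 ∷ ca 1 4 1 ∷ cb 0 4 2 ∷ ba 0 6 0 ∷ ba 0 5 1 ∷ ab 1 5 0 ∷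
  ab 1 4 1 ∷ ca 0 6 0 ∷ ba 1 5 0 ∷ []

-- For a full row a = 3: the last two lines on the left and the last four on the right, six and nine
-- pegs. The hole needed for the first jump lies on an adjoining empty line.
leftEnd rightEnd : List Move
leftEnd =
  cb 2 0 4 ∷ cb 1 0 5 ∷ ab 1 1 4 ∷ cb 0 0 6 ∷ ca 0 2 4 ∷ ba 1 1 4 ∷ []
rightEnd =
  bc 2 4 0 ∷ ac 1 4 1 ∷ ba 0 3 3 ∷ bc 0 5 1 ∷ ba 0 6 0 ∷ ca 0 5 1 ∷ bc 2 4 0 ∷ cb 2 3 1 ∷ ba 1 4 1 ∷
  []

leftPre leftPost rightPre rightPost : ℕ → Maybe Bool
leftPre k = if k <ᵇ 4 then just true else nothing
leftPost k = if k <ᵇ 4 then just false else nothing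
rightPre k = if k <ᵇ 4 then nothing else just true
rightPost k = if k <ᵇ 4 then nothing else just false

pair : ℕ → Bool → ℕ → Maybe Bool
pair zero    u zero          = just u
pair zero    u (suc zero)    = just (not u)
pair zero    u (suc (suc k)) = nothing
pair (suc i) u zero          = nothing
pair (suc i) u (suc k)       = pair i u k

fit-pair : ∀ i u (v : ℕ → Bool) → v i ≡ u → v (suc i) ≡ not u → ∀ k → Fit (pair i u k) (v k)
fit-pair zero    u v e e′ zero          = e
fit-pair zero    u v e e′ (suc zero)    = e′
fit-pair zero    u v e e′ (suc (suc k)) = tt
fit-pair (suc i) u v e e′ zero          = tt
fit-pair (suc i) u v e e′ (suc k)       = fit-pair i u (v ∘ suc) e e′ k

-- Here `a` counts from the row beyond the strip. In T₉ that row has six holes, whence the 5.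
bottomCell : ℕ → ℕ → ℕ → Cell
bottomCell β γ k = ⟨ 0 , k + β , (5 ∸ k) + γ ⟩

fit-row : ∀ {row : ℕ → Maybe Bool} {β γ} {Q : Pos} → (∀ k → Fit (row k) (Q (bottomCell β γ k))) →
          ∀ b c → 2 + (b + c) ≡ 7 → Fit (row b) (Q ⟨ 0 , b + β , c + γ ⟩)
fit-row {row} {β} {γ} {Q} h b c e = subst (λ i → Fit (row b) (Q ⟨ 0 , b + β , i + γ ⟩)) 5∸b≡c (h b)
  where
  5∸b≡c : 5 ∸ b ≡ c
  5∸b≡c = trans (cong (_∸ b) (sym (+-cancelˡ-≡ 2 (b + c) 5 e))) (m+n∸m≡n b c)

clear-left : ∀ n {j Q} ms row → leads 8 ms (strip leftPre (bottom row)) (strip leftPost (bottom row)) ≡ true →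
             (∀ k → Fit (row k) (Q (bottomCell 0 n k))) → 4 ≤ j →
             Reach (8 + n) (strip (gap 4 j) Q) (strip (gap 0 j) Q)
clear-left n {j} {Q} ms row ok hrow hj = strip-window 7 ms leftPre leftPost row ok 0 n refl
  pre post (λ _ ()) (fit-row {row} {0} {n} {Q} hrow) (inj₂ λ { _ (s≤s (s≤s (s≤s (s≤s h)))) → refl })
  where
  pre : ∀ k → Fit (leftPre k) (gap 4 j (k + 0))
  pre 0 = refl
  pre 1 = refl
  pre 2 = refl
  pre 3 = refl
  pre (suc (suc (suc (suc k)))) = tt
  post : ∀ k → Upd (leftPost k) (gap 4 j (k + 0)) (gap 0 j (k + 0))
  post 0 = gap-inside z≤n (≤-trans (s≤s z≤n) hj)
  post 1 = gap-inside z≤n (≤-trans (s≤s (s≤s z≤n)) hj)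
  post 2 = gap-inside z≤n (≤-trans (s≤s (s≤s (s≤s z≤n))) hj)
  post 3 = gap-inside z≤n hj
  post (suc (suc (suc (suc k)))) = refl

clear-right : ∀ n {i Q} ms row → leads 8 ms (strip rightPre (bottom row)) (strip rightPost (bottom row)) ≡ true →
              (∀ k → Fit (row k) (Q (bottomCell n 0 k))) → i ≤ 4 + n →
              Reach (8 + n) (strip (gap i (4 + n)) Q) (strip (gap i (9 + n)) Q)
clear-right n {i} {Q} ms row ok hrow hi =
  strip-window 7 ms rightPre rightPost row ok n 0 {gap i (4 + n)} {τ′} {Q} (cong (8 +_) (+-identityʳ n))
    pre post low (fit-row {row} {n} {0} {Q} hrow) (inj₁ refl)
  ⨾ done (strip-≈ {τ = τ′} {gap i (9 + n)} {Q} τ′≈)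
  where
  -- `rightPost` empties all lines from 4 on, even those past the board, where `gap i (9 + n)` is
  -- full again. `τ′` follows the former and agrees with the latter on the board.
  τ′ : ℕ → Bool
  τ′ b = if b <ᵇ 4 + n then gap i (4 + n) b else false
  τ′≈ : ∀ b → b ≤ 8 + n → τ′ b ≡ gap i (9 + n) b
  τ′≈ b hb with b <? 4 + n
  ... | yes h rewrite <⇒<ᵇ-true h | <⇒<ᵇ-true {b} {9 + n} (s≤s hb) = refl
  ... | no h rewrite ≥⇒<ᵇ-false (≮⇒≥ h) = sym (gap-inside (≤-trans hi (≮⇒≥ h)) (s≤s hb))
  pre : ∀ k → Fit (rightPre k) (gap i (4 + n) (k + n))
  pre 0 = tt
  pre 1 = tt
  pre 2 = tt
  pre 3 = tt
  pre (suc (suc (suc (suc k)))) = gap-right {i} (+-monoʳ-≤ 4 (m≤n+m n k))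
  low : ∀ b → b < n → τ′ b ≡ gap i (4 + n) b
  low b h rewrite <⇒<ᵇ-true {b} {4 + n} (≤-trans h (m≤n+m n 4)) = refl
  post : ∀ k → Upd (rightPost k) (gap i (4 + n) (k + n)) (τ′ (k + n))
  post 0 rewrite <⇒<ᵇ-true {n} {4 + n} (m≤n+m (suc n) 3) = refl
  post 1 rewrite <⇒<ᵇ-true {n} {3 + n} (m≤n+m (suc n) 2) = refl
  post 2 rewrite <⇒<ᵇ-true {n} {2 + n} (m≤n+m (suc n) 1) = refl
  post 3 rewrite <⇒<ᵇ-true {n} {1 + n} ≤-refl = refl
  post (suc (suc (suc (suc k)))) rewrite ≥⇒<ᵇ-false {k + n} {n} (m≤n+m n k) = refl

-- Interrupting a game on the smaller board.

record Triple (M : ℕ) : Set where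
  field
    t₀ t₁ t₂       : Cell
    on₀            : size t₀ ≡ M
    on₁            : size t₁ ≡ M
    on₂            : size t₂ ≡ M
    t₀≢t₁          : t₀ ≢ t₁
    t₀≢t₂          : t₀ ≢ t₂
    t₁≢t₂          : t₁ ≢ t₂

  Constant : Bool → Pos → Set
  Constant u Q = Q t₀ ≡ u × Q t₁ ≡ u × Q t₂ ≡ u

  -- Being non-constant is stated as a difference between neighbours, because the clearing games ask
  -- for a peg next to a hole.
  Mixed : Pos → Set
  Mixed Q = Q t₁ ≡ not (Q t₀) ⊎ Q t₂ ≡ not (Q t₁)

  mixed-or-constant : ∀ Q → Mixed Q ⊎ ∃[ u ] Constant u Q
  mixed-or-constant Q with Q t₀ | Q t₁ | Q t₂
  ... | true  | true  | true  = inj₂ (true , refl , refl , refl)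
  ... | true  | true  | false = inj₁ (inj₂ refl)
  ... | true  | false | _     = inj₁ (inj₁ refl)
  ... | false | true  | _     = inj₁ (inj₁ refl)
  ... | false | false | true  = inj₁ (inj₂ refl)
  ... | false | false | false = inj₂ (false , refl , refl , refl)

  mixed-or-full : ∀ Q → ¬ Constant false Q → Mixed Q ⊎ Constant true Q
  mixed-or-full Q h with mixed-or-constant Q
  ... | inj₁ m           = inj₁ m
  ... | inj₂ (true  , e) = inj₂ e
  ... | inj₂ (false , e) = contradiction e h

  constant-≈ : ∀ {u Q Q′} → Q ≈[ M ] Q′ → Constant u Q → Constant u Q′
  constant-≈ e (e₀ , e₁ , e₂) = trans (sym (e _ on₀)) e₀ , trans (sym (e _ on₁)) e₁ , trans (sym (e _ on₂)) e₂

open Triple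

removed : ∀ {M Q Q′} (s : Step M Q Q′) p → size p ≡ M → Q p ≡ true → Q′ p ≡ false →
          p ≡ from (move s) ⊎ p ≡ over (move s)
removed s p h e e′ with p == from (move s) in ef | p == over (move s) in eo | p == to (move s) in et
... | true  | _     | _ = inj₁ (==-true ef)
... | false | true  | _ = inj₂ (==-true eo)
... | false | false | true = contradiction
  (trans (sym e) (trans (cong _ (==-true {p} et)) (to-before s))) λ ()
... | false | false | false = contradiction
  (trans (sym e) (trans (sym (unchanged s p h (==-false ef) (==-false eo) (==-false et))) e′)) λ ()

full↛empty : ∀ {M Q Q′} (t : Triple M) → Step M Q Q′ → Constant t true Q → ¬ Constant t false Q′
full↛empty t s (e₀ , e₁ , e₂) (f₀ , f₁ , f₂)
  with removed s (t₀ t) (on₀ t) e₀ f₀ | removed s (t₁ t) (on₁ t) e₁ f₁ | removed s (t₂ t) (on₂ t) e₂ f₂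
... | inj₁ u | inj₁ v | _      = t₀≢t₁ t (trans u (sym v))
... | inj₂ u | inj₂ v | _      = t₀≢t₁ t (trans u (sym v))
... | inj₁ u | inj₂ v | inj₁ w = t₀≢t₂ t (trans u (sym w))
... | inj₁ u | inj₂ v | inj₂ w = t₁≢t₂ t (trans v (sym w))
... | inj₂ u | inj₁ v | inj₁ w = t₁≢t₂ t (trans v (sym w))
... | inj₂ u | inj₁ v | inj₂ w = t₀≢t₂ t (trans u (sym w))

up : Cell → Cell
up ⟨ a , b , c ⟩ = ⟨ 3 + a , b , c ⟩

-- With the 3 added on the left, unlike in `shift`, the function `strip` reduces on the raised
-- holes.
raise : Move → Move
raise (ab a b c) = ab (3 + a) b c
raise (ac a b c) = ac (3 + a) b c
raise (ba a b c) = ba (3 + a) b c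
raise (bc a b c) = bc (3 + a) b c
raise (ca a b c) = ca (3 + a) b c
raise (cb a b c) = cb (3 + a) b c

from-raise : ∀ m → from (raise m) ≡ up (from m)
from-raise (ab _ _ _) = refl
from-raise (ac _ _ _) = refl
from-raise (ba _ _ _) = refl
from-raise (bc _ _ _) = refl
from-raise (ca _ _ _) = refl
from-raise (cb _ _ _) = refl

over-raise : ∀ m → over (raise m) ≡ up (over m)
over-raise (ab _ _ _) = refl
over-raise (ac _ _ _) = refl
over-raise (ba _ _ _) = refl
over-raise (bc _ _ _) = refl
over-raise (ca _ _ _) = refl
over-raise (cb _ _ _) = refl

to-raise : ∀ m → to (raise m) ≡ up (to m)
to-raise (ab _ _ _) = refl
to-raise (ac _ _ _) = refl
to-raise (ba _ _ _) = refl
to-raise (bc _ _ _) = refl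
to-raise (ca _ _ _) = refl
to-raise (cb _ _ _) = refl

raise-step : ∀ {M τ Q Q′} → Step M Q Q′ → Step (3 + M) (strip τ Q) (strip τ Q′)
raise-step {M} {τ} {Q} {Q′} s = record
  { move = raise m
  ; on-board = trans (cong size (from-raise m)) (cong (3 +_) (on-board s))
  ; from-before = trans (cong (strip τ Q) (from-raise m)) (from-before s)
  ; over-before = trans (cong (strip τ Q) (over-raise m)) (over-before s)
  ; to-before = trans (cong (strip τ Q) (to-raise m)) (to-before s)
  ; from-after = trans (cong (strip τ Q′) (from-raise m)) (from-after s)
  ; over-after = trans (cong (strip τ Q′) (over-raise m)) (over-after s)
  ; to-after = trans (cong (strip τ Q′) (to-raise m)) (to-after s)
  ; unchanged = same-elsewhere }
  where
  m = move s
  up-≢ : ∀ {p q q′} → q′ ≡ up q → up p ≢ q′ → p ≢ q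
  up-≢ e h refl = h (sym e)
  same-elsewhere : ∀ p → size p ≡ 3 + M → p ≢ from (raise m) → p ≢ over (raise m) → p ≢ to (raise m) →
                   strip τ Q′ p ≡ strip τ Q p
  same-elsewhere ⟨ 0 , b , c ⟩ _ _ _ _ = refl
  same-elsewhere ⟨ 1 , b , c ⟩ _ _ _ _ = refl
  same-elsewhere ⟨ 2 , b , c ⟩ _ _ _ _ = refl
  same-elsewhere ⟨ suc (suc (suc a)) , b , c ⟩ h u v w =
    unchanged s ⟨ a , b , c ⟩ (suc-injective (suc-injective (suc-injective h)))
      (up-≢ (from-raise m) u) (up-≢ (over-raise m) v) (up-≢ (to-raise m) w)

raise-≈ : ∀ {M τ Q Q′} → Q ≈[ M ] Q′ → strip τ Q ≈[ 3 + M ] strip τ Q′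
raise-≈ e ⟨ 0 , b , c ⟩ h = refl
raise-≈ e ⟨ 1 , b , c ⟩ h = refl
raise-≈ e ⟨ 2 , b , c ⟩ h = refl
raise-≈ e ⟨ suc (suc (suc a)) , b , c ⟩ h = e ⟨ a , b , c ⟩ (suc-injective (suc-injective (suc-injective h)))

raise-reach : ∀ {M τ Q Q′} → Reach M Q Q′ → Reach (3 + M) (strip τ Q) (strip τ Q′)
raise-reach (done e)   = done (raise-≈ e)
raise-reach (s then r) = raise-step s then raise-reach r

-- In continuation form: `k` receives the first position in which the triple is mixed and the rest
-- of the game, to be resumed after the interruption. Until then the triple is full, and a full
-- triple does not become empty in one jump.
at-mixed : ∀ {M τ Q Q′ R} (t : Triple M) → Reach M Q Q′ → ¬ Constant t false Q → ¬ Constant t true Q′ →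
           (∀ Q₁ → Mixed t Q₁ → Reach M Q₁ Q′ → Reach (3 + M) (strip τ Q₁) R) → Reach (3 + M) (strip τ Q) R
at-mixed {Q = Q} t r ne nf k with mixed-or-full t Q ne
at-mixed t r ne nf k          | inj₁ m = k _ m r
at-mixed t (done e) ne nf k   | inj₂ f = contradiction (constant-≈ t e f) nf
at-mixed t (s then r) ne nf k | inj₂ f = raise-step s then at-mixed t r (full↛empty t s f) nf k

module _ (n : ℕ) where

  left right : Triple (5 + n)
  left = record
    { t₀ = bottomCell 0 n 0 ; t₁ = bottomCell 0 n 1 ; t₂ = bottomCell 0 n 2
    ; on₀ = refl ; on₁ = refl ; on₂ = refl
    ; t₀≢t₁ = λ () ; t₀≢t₂ = λ () ; t₁≢t₂ = λ () }
  right = record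
    { t₀ = bottomCell n 0 3 ; t₁ = bottomCell n 0 4 ; t₂ = bottomCell n 0 5
    ; on₀ = cong (3 +_) (+-comm n 2) ; on₁ = cong (4 +_) (+-comm n 1) ; on₂ = cong (5 +_) (+-comm n 0)
    ; t₀≢t₁ = λ () ; t₀≢t₂ = λ () ; t₁≢t₂ = λ () }

  purge-left : ∀ {j Q} → Mixed left Q → 4 ≤ j → Reach (8 + n) (strip (gap 4 j) Q) (strip (gap 0 j) Q)
  purge-left {Q = Q} (inj₁ e) hj with Q (t₀ left) in e₀
  ... | true  = clear-left n (leftMoves₁ true) (pair 0 true) refl (fit-pair 0 true (Q ∘ bottomCell 0 n) e₀ e) hj
  ... | false = clear-left n (leftMoves₁ false) (pair 0 false) refl (fit-pair 0 false (Q ∘ bottomCell 0 n) e₀ e) hj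
  purge-left {Q = Q} (inj₂ e) hj with Q (t₁ left) in e₁
  ... | true  = clear-left n (leftMoves₂ true) (pair 1 true) refl (fit-pair 1 true (Q ∘ bottomCell 0 n) e₁ e) hj
  ... | false = clear-left n (leftMoves₂ false) (pair 1 false) refl (fit-pair 1 false (Q ∘ bottomCell 0 n) e₁ e) hj

  purge-right : ∀ {i Q} → Mixed right Q → i ≤ 4 + n →
                Reach (8 + n) (strip (gap i (4 + n)) Q) (strip (gap i (9 + n)) Q)
  purge-right {Q = Q} (inj₁ e) hi with Q (t₀ right) in e₀
  ... | true  = clear-right n (rightMoves₁ true) (pair 3 true) refl (fit-pair 3 true (Q ∘ bottomCell n 0) e₀ e) hi
  ... | false = clear-right n (rightMoves₁ false) (pair 3 false) refl (fit-pair 3 false (Q ∘ bottomCell n 0) e₀ e) hi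
  purge-right {Q = Q} (inj₂ e) hi with Q (t₁ right) in e₁
  ... | true  = clear-right n (rightMoves₂ true) (pair 4 true) refl (fit-pair 4 true (Q ∘ bottomCell n 0) e₁ e) hi
  ... | false = clear-right n (rightMoves₂ false) (pair 4 false) refl (fit-pair 4 false (Q ∘ bottomCell n 0) e₁ e) hi

  full-gap : ∀ i b → true ≡ gap i i b
  full-gap i b with b <ᵇ i
  ... | true  = refl
  ... | false = refl

  bound : 3 + (n + 3) ≤ 8 + n
  bound = ≤-trans (≤-reflexive (cong (3 +_) (+-comm n 3))) (m≤n+m (6 + n) 2)

  -- Clearing the end creates the empty line from which the sweeps start; they stop at the lines
  -- that `purge-right` takes.
  purge-left-first : ∀ {Q} → Mixed left Q → Reach (8 + n) (strip (λ _ → true) Q) (strip (gap 0 (4 + n)) Q)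
  purge-left-first {Q} m = ≈-reach (strip-≈ {Q = Q} λ b _ → full-gap 4 b)
    (purge-left m ≤-refl ⨾ subst (λ k → Reach (8 + n) (strip (gap 0 4) Q) (strip (gap 0 k) Q))
      (cong suc (+-comm n 3)) (sweepsʳ n 3 bound))

  purge-right-first : ∀ {Q} → Mixed right Q → Reach (8 + n) (strip (λ _ → true) Q) (strip (gap 4 (9 + n)) Q)
  purge-right-first {Q} m = ≈-reach (strip-≈ {Q = Q} λ b _ → full-gap (4 + n) b)
    (purge-right m ≤-refl ⨾ subst (λ k → Reach (8 + n) (strip (gap k (9 + n)) Q) (strip (gap 4 (9 + n)) Q))
      (cong suc (+-comm n 3)) (sweepsˡ n 3 bound bound′))
    where
    bound′ : 2 + (n + 3) ≤ 9 + n
    bound′ = ≤-trans (≤-reflexive (cong (2 +_) (+-comm n 3))) (m≤n+m (5 + n) 4)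

  cleared : ∀ {Q} → strip (gap 0 (9 + n)) Q ≈[ 8 + n ] strip (λ _ → false) Q
  cleared = strip-≈ λ b h → gap-inside z≤n (s≤s h)

  -- A game on the rows a ≥ 3 can be interrupted twice to clear the strip: each end of the strip is
  -- cleared when the triple next to it is neither full nor empty, and whichever end comes first
  -- also takes the middle.
  clear-strip-meanwhile : ∀ {Q Q′} → Reach (5 + n) Q Q′ →
    ¬ Constant left false Q → ¬ Constant right false Q → ¬ Constant left true Q′ → ¬ Constant right true Q′ →
    Reach (8 + n) (strip (λ _ → true) Q) (strip (λ _ → false) Q′)
  clear-strip-meanwhile {Q} {Q′} r nel ner nfl nfr with mixed-or-full left Q nel | mixed-or-full right Q ner
  clear-strip-meanwhile r nel ner nfl nfr | inj₁ m | _ =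
    purge-left-first m ⨾ at-mixed right r ner nfr
      λ Q₁ m₁ r₁ → purge-right m₁ z≤n ⨾ raise-reach r₁ ⨾ done cleared
  clear-strip-meanwhile r nel ner nfl nfr | inj₂ _ | inj₁ m =
    purge-right-first m ⨾ at-mixed left r nel nfl
      λ Q₁ m₁ r₁ → purge-left m₁ (m≤m+n 4 (5 + n)) ⨾ raise-reach r₁ ⨾ done cleared
  clear-strip-meanwhile (done e) nel ner nfl nfr | inj₂ f | inj₂ _ = contradiction (constant-≈ left e f) nfl
  clear-strip-meanwhile (s then r) nel ner nfl nfr | inj₂ f | inj₂ f′ =
    raise-step s then clear-strip-meanwhile r (full↛empty left s f) (full↛empty right s f′) nfl nfr

-- Residues modulo 3.

data ℤ₃ : Set where
  0₃ 1₃ 2₃ : ℤ₃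

next : ℤ₃ → ℤ₃
next 0₃ = 1₃
next 1₃ = 2₃
next 2₃ = 0₃

infixl 6 _⊹_
_⊹_ : ℤ₃ → ℤ₃ → ℤ₃
0₃ ⊹ v = v
1₃ ⊹ v = next v
2₃ ⊹ v = next (next v)

-- Residues in a three-element type allow proofs by cases; `residue-mod3` is the link with `_% 3`.
mod3 : ℕ → ℤ₃
mod3 zero    = 0₃
mod3 (suc n) = next (mod3 n)

next³ : ∀ u → next (next (next u)) ≡ u
next³ 0₃ = refl
next³ 1₃ = refl
next³ 2₃ = refl

next-⊹ : ∀ u v → next u ⊹ v ≡ next (u ⊹ v)
next-⊹ 0₃ v = refl
next-⊹ 1₃ v = refl
next-⊹ 2₃ v = sym (next³ v)

mod3-+ : ∀ m n → mod3 (m + n) ≡ mod3 m ⊹ mod3 n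
mod3-+ zero    n = refl
mod3-+ (suc m) n = trans (cong next (mod3-+ m n)) (sym (next-⊹ (mod3 m) (mod3 n)))

_≡₃_ : ℤ₃ → ℤ₃ → Bool
0₃ ≡₃ 0₃ = true
1₃ ≡₃ 1₃ = true
2₃ ≡₃ 2₃ = true
_  ≡₃ _  = false

≡₃-true : ∀ u v → (u ≡₃ v) ≡ true → u ≡ v
≡₃-true 0₃ 0₃ _ = refl
≡₃-true 1₃ 1₃ _ = refl
≡₃-true 2₃ 2₃ _ = refl

-- The residue of x + y, where x = b and y = b + c.
colour : Cell → ℤ₃
colour ⟨ _ , b , c ⟩ = mod3 (b + (b + c))

colour-⊞ : ∀ p o → colour (p ⊞ o) ≡ colour p ⊹ colour o
colour-⊞ ⟨ _ , b , c ⟩ ⟨ _ , β , γ ⟩ = trans (cong mod3 (regroup b c β γ)) (mod3-+ (b + (b + c)) (β + (β + γ)))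
  where
  regroup : ∀ b c β γ → b + β + (b + β + (c + γ)) ≡ b + (b + c) + (β + (β + γ))
  regroup = solve-∀

-- A final hole in the strip.

-- Games on T₉ (a + b + c = 8), found by computer search, from the vacancy p in the strip to a vacancy in
-- the rows a ≥ 4, clearing the lines lo b ≤ b′ < hi b of the strip. The row a = 3 ends up full, as needed to
-- clear the ends of the strip later on; stripTarget omits the four rows below a = 4.
stripTarget : Cell → Cell
stripTarget ⟨ 0 , 0 , _ ⟩ = ⟨ 0 , 1 , 3 ⟩
stripTarget ⟨ 0 , 1 , _ ⟩ = ⟨ 0 , 2 , 2 ⟩
stripTarget ⟨ 0 , 2 , _ ⟩ = ⟨ 0 , 0 , 4 ⟩
stripTarget ⟨ 0 , 3 , _ ⟩ = ⟨ 0 , 1 , 3 ⟩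
stripTarget ⟨ 0 , 4 , _ ⟩ = ⟨ 1 , 3 , 0 ⟩
stripTarget ⟨ 0 , 5 , _ ⟩ = ⟨ 0 , 3 , 1 ⟩
stripTarget ⟨ 0 , 6 , _ ⟩ = ⟨ 0 , 4 , 0 ⟩
stripTarget ⟨ 0 , 7 , _ ⟩ = ⟨ 1 , 3 , 0 ⟩
stripTarget ⟨ 0 , 8 , _ ⟩ = ⟨ 0 , 3 , 1 ⟩
stripTarget ⟨ 1 , 0 , _ ⟩ = ⟨ 0 , 0 , 4 ⟩
stripTarget ⟨ 1 , 1 , _ ⟩ = ⟨ 0 , 1 , 3 ⟩
stripTarget ⟨ 1 , 2 , _ ⟩ = ⟨ 1 , 0 , 3 ⟩
stripTarget ⟨ 1 , 3 , _ ⟩ = ⟨ 1 , 1 , 2 ⟩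
stripTarget ⟨ 1 , 4 , _ ⟩ = ⟨ 0 , 4 , 0 ⟩
stripTarget ⟨ 1 , 5 , _ ⟩ = ⟨ 1 , 3 , 0 ⟩
stripTarget ⟨ 1 , 6 , _ ⟩ = ⟨ 0 , 3 , 1 ⟩
stripTarget ⟨ 1 , 7 , _ ⟩ = ⟨ 0 , 4 , 0 ⟩
stripTarget ⟨ 2 , 0 , _ ⟩ = ⟨ 1 , 0 , 3 ⟩
stripTarget ⟨ 2 , 1 , _ ⟩ = ⟨ 0 , 0 , 4 ⟩
stripTarget ⟨ 2 , 2 , _ ⟩ = ⟨ 0 , 1 , 3 ⟩
stripTarget ⟨ 2 , 3 , _ ⟩ = ⟨ 0 , 2 , 2 ⟩
stripTarget ⟨ 2 , 4 , _ ⟩ = ⟨ 0 , 3 , 1 ⟩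
stripTarget ⟨ 2 , 5 , _ ⟩ = ⟨ 0 , 4 , 0 ⟩
stripTarget ⟨ 2 , 6 , _ ⟩ = ⟨ 1 , 3 , 0 ⟩
stripTarget p = p

stripMoves : Cell → List Move
stripMoves ⟨ 0 , 0 , _ ⟩ =
  bc 0 0 6 ∷ ac 0 1 5 ∷ bc 2 1 3 ∷ ab 2 1 3 ∷ cb 0 0 6 ∷ ca 0 2 4 ∷ ab 1 0 5 ∷ ca 1 2 3 ∷ ca 1 0 5 ∷
  bc 2 2 2 ∷ ca 0 3 3 ∷ cb 2 2 2 ∷ []
stripMoves ⟨ 0 , 1 , _ ⟩ =
  bc 0 1 5 ∷ ab 0 0 6 ∷ ca 0 0 6 ∷ ac 1 0 5 ∷ cb 0 1 5 ∷ bc 2 0 4 ∷ ac 2 2 2 ∷ ca 1 2 3 ∷ ca 1 0 5 ∷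
  bc 2 2 2 ∷ ca 0 3 3 ∷ cb 2 2 2 ∷ []
stripMoves ⟨ 0 , 2 , _ ⟩ =
  cb 0 0 6 ∷ ac 0 1 5 ∷ bc 2 1 3 ∷ cb 2 0 4 ∷ ba 0 1 5 ∷ cb 0 1 5 ∷ ac 2 0 4 ∷ ca 1 0 5 ∷ cb 2 1 3 ∷
  bc 2 2 2 ∷ ca 0 3 3 ∷ cb 2 2 2 ∷ []
stripMoves ⟨ 0 , 3 , _ ⟩ =
  cb 0 1 5 ∷ ac 0 2 4 ∷ bc 2 2 2 ∷ ab 2 1 3 ∷ ba 1 2 3 ∷ cb 2 1 3 ∷ ba 0 2 4 ∷ bc 0 1 5 ∷ bc 2 1 3 ∷
  []
stripMoves ⟨ 0 , 4 , _ ⟩ =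
  ac 0 4 2 ∷ bc 2 4 0 ∷ ca 0 5 1 ∷ bc 0 5 1 ∷ cb 0 4 2 ∷ ba 0 6 0 ∷ ab 1 5 0 ∷ ca 0 6 0 ∷ ab 3 3 0 ∷
  ba 2 4 0 ∷ cb 2 4 0 ∷ ba 1 5 0 ∷ cb 2 2 2 ∷ ca 0 3 3 ∷ bc 2 2 2 ∷ []
stripMoves ⟨ 0 , 5 , _ ⟩ =
  bc 0 5 1 ∷ ab 0 4 2 ∷ ac 1 5 0 ∷ ab 2 3 1 ∷ ba 1 4 1 ∷ ba 1 5 0 ∷ cb 0 5 1 ∷ bc 0 6 0 ∷ ba 0 4 2 ∷
  ab 1 3 2 ∷ ca 0 4 2 ∷ ba 1 3 2 ∷ cb 2 2 2 ∷ ca 0 3 3 ∷ bc 2 2 2 ∷ []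
stripMoves ⟨ 0 , 6 , _ ⟩ =
  cb 0 4 2 ∷ ac 0 5 1 ∷ ab 1 3 2 ∷ ac 2 4 0 ∷ ba 1 3 2 ∷ ba 0 5 1 ∷ cb 0 5 1 ∷ bc 0 6 0 ∷ ac 1 5 0 ∷
  ba 0 4 2 ∷ ba 1 5 0 ∷ ca 1 4 1 ∷ cb 2 2 2 ∷ ca 0 3 3 ∷ bc 2 2 2 ∷ []
stripMoves ⟨ 0 , 7 , _ ⟩ =
  cb 0 5 1 ∷ ab 0 4 2 ∷ bc 2 4 0 ∷ bc 0 5 1 ∷ cb 0 4 2 ∷ ba 0 6 0 ∷ ab 1 5 0 ∷ bc 1 5 0 ∷ ab 3 3 0 ∷
  ca 2 4 0 ∷ ba 0 4 2 ∷ ca 1 4 1 ∷ cb 2 2 2 ∷ ca 0 3 3 ∷ bc 2 2 2 ∷ []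
stripMoves ⟨ 0 , 8 , _ ⟩ =
  cb 0 6 0 ∷ ab 0 4 2 ∷ ac 1 5 0 ∷ ab 2 3 1 ∷ ba 1 4 1 ∷ ba 1 5 0 ∷ cb 0 5 1 ∷ bc 0 6 0 ∷ ba 0 4 2 ∷
  ab 1 3 2 ∷ ca 0 4 2 ∷ ba 1 3 2 ∷ cb 2 2 2 ∷ ca 0 3 3 ∷ bc 2 2 2 ∷ []
stripMoves ⟨ 1 , 0 , _ ⟩ =
  ac 1 0 5 ∷ bc 2 0 4 ∷ ab 2 0 4 ∷ bc 2 1 3 ∷ cb 2 0 4 ∷ ba 1 1 4 ∷ ca 0 2 4 ∷ cb 0 0 6 ∷ bc 0 1 5 ∷
  ca 0 1 5 ∷ bc 2 0 4 ∷ ca 1 0 5 ∷ []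
stripMoves ⟨ 1 , 1 , _ ⟩ =
  ac 1 1 4 ∷ ba 1 1 4 ∷ ac 1 3 2 ∷ ab 2 1 3 ∷ ca 1 3 2 ∷ ca 0 1 5 ∷ bc 0 1 5 ∷ cb 0 0 6 ∷ ca 0 2 4 ∷
  ab 1 0 5 ∷ ca 1 2 3 ∷ ca 1 0 5 ∷ []
stripMoves ⟨ 1 , 2 , _ ⟩ =
  ac 1 2 3 ∷ ca 0 2 4 ∷ ab 1 0 5 ∷ cb 0 0 6 ∷ ac 3 0 3 ∷ ca 2 0 4 ∷ ba 0 0 6 ∷ ca 1 2 3 ∷ ca 1 0 5 ∷
  bc 2 2 2 ∷ ca 0 3 3 ∷ cb 2 2 2 ∷ []
stripMoves ⟨ 1 , 3 , _ ⟩ =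
  ab 1 1 4 ∷ ac 3 1 2 ∷ ba 2 1 3 ∷ bc 2 3 1 ∷ ca 0 4 2 ∷ cb 0 2 4 ∷ ba 0 2 4 ∷ ca 1 2 3 ∷ cb 2 3 1 ∷
  []
stripMoves ⟨ 1 , 4 , _ ⟩ =
  ac 1 4 1 ∷ bc 2 4 0 ∷ ab 2 4 0 ∷ ca 1 4 1 ∷ ba 1 5 0 ∷ ba 0 5 1 ∷ cb 0 5 1 ∷ bc 0 6 0 ∷ cb 0 3 3 ∷
  bc 0 4 2 ∷ ac 0 5 1 ∷ bc 0 3 3 ∷ cb 2 2 2 ∷ ca 0 3 3 ∷ bc 2 2 2 ∷ []
stripMoves ⟨ 1 , 5 , _ ⟩ =
  ab 1 3 2 ∷ ac 3 3 0 ∷ ba 2 3 1 ∷ ca 0 5 1 ∷ bc 2 4 0 ∷ ba 0 6 0 ∷ bc 0 5 1 ∷ cb 0 4 2 ∷ ab 1 5 0 ∷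
  ca 0 6 0 ∷ ba 1 5 0 ∷ ca 1 4 1 ∷ cb 2 2 2 ∷ ca 0 3 3 ∷ bc 2 2 2 ∷ []
stripMoves ⟨ 1 , 6 , _ ⟩ =
  ab 1 4 1 ∷ cb 2 3 1 ∷ ac 2 3 1 ∷ bc 2 4 0 ∷ ca 1 3 2 ∷ ca 1 4 1 ∷ ba 0 4 2 ∷ bc 0 6 0 ∷ cb 0 5 1 ∷
  ba 0 5 1 ∷ cb 0 3 3 ∷ ac 1 5 0 ∷ ca 0 5 1 ∷ cb 2 4 0 ∷ ba 1 5 0 ∷ []
stripMoves ⟨ 1 , 7 , _ ⟩ =
  ab 1 5 0 ∷ cb 2 4 0 ∷ ac 2 4 0 ∷ ca 1 4 1 ∷ ba 1 5 0 ∷ ba 0 5 1 ∷ cb 0 5 1 ∷ bc 0 6 0 ∷ cb 0 3 3 ∷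
  bc 0 4 2 ∷ ac 0 5 1 ∷ bc 0 3 3 ∷ cb 2 2 2 ∷ ca 0 3 3 ∷ bc 2 2 2 ∷ []
stripMoves ⟨ 2 , 0 , _ ⟩ =
  ca 0 0 6 ∷ ac 1 0 5 ∷ ac 3 0 3 ∷ bc 0 0 6 ∷ ca 0 0 6 ∷ bc 1 0 5 ∷ ca 2 0 4 ∷ bc 2 0 4 ∷ ca 1 0 5 ∷
  bc 2 2 2 ∷ ca 0 3 3 ∷ cb 2 2 2 ∷ []
stripMoves ⟨ 2 , 1 , _ ⟩ =
  bc 2 1 3 ∷ ca 0 2 4 ∷ cb 2 1 3 ∷ cb 0 0 6 ∷ bc 0 1 5 ∷ ab 0 0 6 ∷ cb 0 1 5 ∷ ac 2 0 4 ∷ ca 1 0 5 ∷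
  bc 2 2 2 ∷ ca 0 3 3 ∷ cb 2 2 2 ∷ []
stripMoves ⟨ 2 , 2 , _ ⟩ =
  ca 0 2 4 ∷ ac 1 2 3 ∷ cb 0 0 6 ∷ ca 0 2 4 ∷ ab 1 0 5 ∷ ca 1 2 3 ∷ ac 2 1 3 ∷ ca 1 1 4 ∷ ca 1 0 5 ∷
  bc 2 2 2 ∷ ca 0 3 3 ∷ cb 2 2 2 ∷ []
stripMoves ⟨ 2 , 3 , _ ⟩ =
  cb 2 1 3 ∷ ac 2 2 2 ∷ bc 2 1 3 ∷ bc 2 3 1 ∷ ca 0 4 2 ∷ cb 0 2 4 ∷ ba 0 2 4 ∷ ca 1 2 3 ∷ cb 2 3 1 ∷
  []
stripMoves ⟨ 2 , 4 , _ ⟩ =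
  bc 2 4 0 ∷ ab 2 3 1 ∷ cb 2 4 0 ∷ ca 0 5 1 ∷ bc 2 4 0 ∷ ba 0 6 0 ∷ bc 0 5 1 ∷ cb 0 4 2 ∷ ab 1 5 0 ∷
  ca 0 6 0 ∷ ba 1 5 0 ∷ ca 1 4 1 ∷ cb 2 2 2 ∷ ca 0 3 3 ∷ bc 2 2 2 ∷ []
stripMoves ⟨ 2 , 5 , _ ⟩ =
  ca 0 5 1 ∷ ab 1 3 2 ∷ ac 2 4 0 ∷ ba 1 3 2 ∷ bc 2 4 0 ∷ ca 1 4 1 ∷ ba 0 6 0 ∷ bc 0 5 1 ∷ cb 0 4 2 ∷
  ab 1 5 0 ∷ ca 0 6 0 ∷ ba 1 5 0 ∷ cb 2 2 2 ∷ ca 0 3 3 ∷ bc 2 2 2 ∷ []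
stripMoves ⟨ 2 , 6 , _ ⟩ =
  cb 2 4 0 ∷ ba 0 4 2 ∷ ab 1 3 2 ∷ bc 3 3 0 ∷ ab 3 3 0 ∷ bc 0 6 0 ∷ ba 2 4 0 ∷ ca 0 6 0 ∷ cb 0 4 2 ∷
  ba 0 4 2 ∷ ba 1 5 0 ∷ ca 1 4 1 ∷ cb 2 2 2 ∷ ca 0 3 3 ∷ bc 2 2 2 ∷ []
stripMoves _ = []

lo hi : ℕ → ℕ
lo 0 = 0
lo 1 = 0
lo 2 = 0
lo 3 = 2
lo _ = 3
hi 0 = 4
hi 1 = 4
hi 2 = 4
hi 3 = 5
hi _ = 9

deeper : Cell → Cell
deeper ⟨ a , b , c ⟩ = ⟨ suc a , b , c ⟩

afterOpening : Cell → Pos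
afterOpening p = strip (gap (lo (Cell.b p)) (hi (Cell.b p))) (allBut (deeper (stripTarget p)))

-- The target has to keep the residue of the vacancy, so that the condition holds for the game on
-- the smaller board.
opening-check : Cell → Bool
opening-check p =
  not (Cell.a p <ᵇ 3) ∨
  leads 8 (stripMoves p) (just ∘ allBut p) (just ∘ afterOpening p)
    ∧ (size (stripTarget p) ≡ᵇ 4) ∧ (colour (stripTarget p) ≡₃ colour p)

opening-checked : allPlane 8 opening-check ≡ true
opening-checked = refl

<ᵇ-+ : ∀ m n k → (m + k <ᵇ n + k) ≡ (m <ᵇ n)
<ᵇ-+ m n zero    rewrite +-identityʳ m | +-identityʳ n = refl
<ᵇ-+ m n (suc k) rewrite +-suc m k | +-suc n k = <ᵇ-+ m n k

gap-+ : ∀ i j b k → gap (i + k) (j + k) (b + k) ≡ gap i j b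
gap-+ i j b k = cong₂ (λ u v → u ∨ not v) (<ᵇ-+ b i k) (<ᵇ-+ b j k)

strip-⊞ : ∀ i j q β γ d → strip (gap (i + β) (j + β)) (allBut (q ⊞ ⟨ 0 , β , γ ⟩)) (d ⊞ ⟨ 0 , β , γ ⟩)
        ≡ strip (gap i j) (allBut q) d
strip-⊞ i j q β γ ⟨ 0 , b , c ⟩ = gap-+ i j b β
strip-⊞ i j q β γ ⟨ 1 , b , c ⟩ = gap-+ i j b β
strip-⊞ i j q β γ ⟨ 2 , b , c ⟩ = gap-+ i j b β
strip-⊞ i j q β γ ⟨ suc (suc (suc a)) , b , c ⟩ = cong not (==-⊞ ⟨ a , b , c ⟩ q ⟨ 0 , β , γ ⟩)

opening : ∀ p β γ → size p ≡ 8 → Cell.a p < 3 → γ ≡ 0 ⊎ hi (Cell.b p) ≤ 7 →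
  let o = ⟨ 0 , β , γ ⟩ ; q = deeper (stripTarget p) ⊞ o in
  size q ≡ 5 + (β + γ) × colour q ≡ colour (p ⊞ o) ×
  Reach (8 + (β + γ)) (allBut (p ⊞ o)) (strip (gap (lo (Cell.b p) + β) (hi (Cell.b p) + β)) (allBut q))
opening p@(⟨ a , b , c ⟩) β γ hp ha hγ
  with checked ← allPlane-sound 8 opening-check opening-checked p hp
  rewrite <⇒<ᵇ-true ha
  with ok , checked′ ← ∧-true {leads 8 (stripMoves p) (just ∘ allBut p) (just ∘ afterOpening p)} checked
  with hs , hc ← ∧-true {size (stripTarget p) ≡ᵇ 4} checked′
  = trans (size-⊞ q′ o) (cong (λ k → suc (k + (β + γ))) (≡ᵇ-true {size (stripTarget p)} hs))
  , trans (colour-⊞ q′ o) (trans (cong (_⊹ colour o) (≡₃-true (colour (stripTarget p)) (colour p) hc))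
      (sym (colour-⊞ p o)))
  , window (stripMoves p) {just ∘ allBut p} {just ∘ afterOpening p} ok
      (λ d _ → cong not (==-⊞ d p o)) (λ d _ → strip-⊞ (lo b) (hi b) q′ β γ d) (out hγ)
  where
  o = ⟨ 0 , β , γ ⟩
  q′ = deeper (stripTarget p)
  open Window 8 (8 + (β + γ)) o refl
  full : ∀ {r s} → r ≢ s → allBut s r ≡ true
  full h = cong not (≢⇒==-false h)
  outside-below : ∀ {r} → Outside o r → allBut (p ⊞ o) r ≡ true
  outside-below h = full (outside-≢ h p)
  lower : ∀ {a a′ b c} → Outside o ⟨ a , b , c ⟩ → Outside o ⟨ a′ , b , c ⟩
  lower (below-b h) = below-b h
  lower (below-c h) = below-c h
  beyond : ∀ a {b′ c′} → a ≤ 2 → c′ < γ → a + (b′ + c′) ≡ 8 + (β + γ) → γ ≡ 0 ⊎ hi b ≤ 7 → hi b + β ≤ b′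
  beyond a a≤2 () h (inj₁ refl)
  beyond a a≤2 c<γ h (inj₂ hi≤) = ≤-trans (+-monoˡ-≤ β hi≤) (beyond-window {7} {β} a a≤2 c<γ h)
  in-strip : ∀ a {b′ c′} → a ≤ 2 → a + (b′ + c′) ≡ 8 + (β + γ) → Outside o ⟨ a , b′ , c′ ⟩ →
             γ ≡ 0 ⊎ hi b ≤ 7 → gap (lo b + β) (hi b + β) b′ ≡ true
  in-strip a a≤2 h (below-b b<β) _ = gap-left (hi b + β) (≤-trans b<β (m≤n+m β (lo b)))
  in-strip a a≤2 h (below-c c<γ) e = gap-right {lo b + β} (beyond a a≤2 c<γ h e)
  out : γ ≡ 0 ⊎ hi b ≤ 7 → ∀ r → size r ≡ 8 + (β + γ) → Outside o r →
        strip (gap (lo b + β) (hi b + β)) (allBut (q′ ⊞ o)) r ≡ allBut (p ⊞ o) r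
  out e ⟨ 0 , b′ , c′ ⟩ h x = trans (in-strip 0 z≤n h x e) (sym (outside-below x))
  out e ⟨ 1 , b′ , c′ ⟩ h x = trans (in-strip 1 (s≤s z≤n) h x e) (sym (outside-below x))
  out e ⟨ 2 , b′ , c′ ⟩ h x = trans (in-strip 2 (s≤s (s≤s z≤n)) h x e) (sym (outside-below x))
  out e ⟨ suc (suc (suc a′)) , b′ , c′ ⟩ h x =
    trans (full {⟨ a′ , b′ , c′ ⟩} (outside-≢ (lower x) q′)) (sym (outside-below x))

known-full : ℕ → Maybe Bool
known-full _ = just true

-- The vacancy `deeper q` avoids the row next to the strip, so that row is full. The sweeps leave
-- two lines to `leftEnd`.
finish-left : ∀ m n {j q} → 4 + m ≤ j → m ≤ 4 + n →
  Reach (8 + n) (strip (gap (2 + m) j) (allBut (deeper q))) (strip (gap 0 j) (allBut (deeper q)))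
finish-left m n {j} {q} hj hm =
  subst (λ k → Reach (8 + n) (strip (gap (suc k) j) Q) (strip (gap 2 j) Q)) (+-comm m 1)
    (sweepsˡ m 1 (≤-trans (≤-reflexive (cong (3 +_) (+-comm m 1))) (+-monoʳ-≤ 4 hm))
                 (≤-trans (≤-reflexive (cong (2 +_) (+-comm m 1))) (≤-trans (n≤1+n _) hj)))
  ⨾ strip-window 7 leftEnd pre post known-full refl 0 n refl hpre hpost (λ _ ()) (λ _ _ _ → refl)
      (inj₂ λ { _ (s≤s (s≤s (s≤s (s≤s h)))) → refl })
  where
  Q = allBut (deeper q)
  4≤j : 4 ≤ j
  4≤j = ≤-trans (m≤m+n 4 m) hj
  pre post : ℕ → Maybe Bool
  pre k = if k <ᵇ 4 then just (k <ᵇ 2) else nothing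
  post k = if k <ᵇ 4 then just false else nothing
  hpre : ∀ k → Fit (pre k) (gap 2 j (k + 0))
  hpre 0 = refl
  hpre 1 = refl
  hpre 2 = gap-inside ≤-refl (<⇒≤ 4≤j)
  hpre 3 = gap-inside (s≤s (s≤s z≤n)) 4≤j
  hpre (suc (suc (suc (suc k)))) = tt
  hpost : ∀ k → Upd (post k) (gap 2 j (k + 0)) (gap 0 j (k + 0))
  hpost 0 = gap-inside z≤n (≤-trans (s≤s z≤n) 4≤j)
  hpost 1 = gap-inside z≤n (≤-trans (s≤s (s≤s z≤n)) 4≤j)
  hpost 2 = gap-inside z≤n (<⇒≤ 4≤j)
  hpost 3 = gap-inside z≤n 4≤j
  hpost (suc (suc (suc (suc k)))) = refl

finish-right : ∀ k n {q} → k ≤ 4 + n →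
  Reach (8 + n) (strip (gap 0 (1 + k)) (allBut (deeper q))) (strip (λ _ → false) (allBut (deeper q)))
finish-right k n {q} hk =
  subst (λ m → Reach (8 + n) (strip (gap 0 (1 + k)) Q) (strip (gap 0 (1 + m)) Q)) m+k≡4+n
    (sweepsʳ (4 + n ∸ k) k (≤-trans (≤-reflexive (cong (3 +_) m+k≡4+n)) (n≤1+n _)))
  ⨾ strip-window 7 rightEnd pre post known-full refl n 0 {gap 0 (5 + n)} {λ _ → false} {Q}
      (cong (8 +_) (+-identityʳ n)) hpre hpost (λ b h → sym (gap-inside z≤n (≤-trans h (m≤n+m n 5))))
      (λ _ _ _ → refl) (inj₁ refl)
  where
  Q = allBut (deeper q)
  m+k≡4+n : 4 + n ∸ k + k ≡ 4 + n
  m+k≡4+n = m∸n+n≡m hk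
  pre post : ℕ → Maybe Bool
  pre k = if k <ᵇ 3 then nothing else just (not (k <ᵇ 5))
  post k = if k <ᵇ 3 then nothing else just false
  hpre : ∀ k → Fit (pre k) (gap 0 (5 + n) (k + n))
  hpre 0 = tt
  hpre 1 = tt
  hpre 2 = tt
  hpre (suc (suc (suc k))) = cong not (<ᵇ-+ (3 + k) 5 n)
  hpost : ∀ k → Upd (post k) (gap 0 (5 + n) (k + n)) false
  hpost 0 = sym (gap-inside z≤n (+-monoˡ-< n {0} {5} (s≤s z≤n)))
  hpost 1 = sym (gap-inside z≤n (+-monoˡ-< n {1} {5} (s≤s (s≤s z≤n))))
  hpost 2 = sym (gap-inside z≤n (+-monoˡ-< n {2} {5} (s≤s (s≤s (s≤s z≤n)))))
  hpost (suc (suc (suc k))) = refl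

Reducible : ℕ → Cell → Set
Reducible n f = ∃[ g ] size g ≡ 5 + n × colour g ≡ colour f ×
                Reach (8 + n) (allBut f) (strip (λ _ → false) (allBut g))

reduce-at : ∀ p β γ {n f} → p ⊞ ⟨ 0 , β , γ ⟩ ≡ f → β + γ ≡ n → size f ≡ 8 + n → Cell.a p < 3 →
  γ ≡ 0 ⊎ hi (Cell.b p) ≤ 7 →
  (∀ q → Reach (8 + n) (strip (gap (lo (Cell.b p) + β) (hi (Cell.b p) + β)) (allBut (deeper q)))
                       (strip (λ _ → false) (allBut (deeper q)))) →
  Reducible n f
reduce-at p β γ refl refl hf ha hγ finish =
  let hs , hc , r = opening p β γ size-p ha hγ in
  deeper (stripTarget p) ⊞ ⟨ 0 , β , γ ⟩ , hs , hc , r ⨾ finish (stripTarget p ⊞ ⟨ 0 , β , γ ⟩)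
  where
  size-p : size p ≡ 8
  size-p = +-cancelʳ-≡ (β + γ) (size p) 8 (trans (sym (size-⊞ p ⟨ 0 , β , γ ⟩)) hf)

-- Makes the truncated subtraction from c in `reduce` exact.
window-fits : ∀ {a b c β γ} → a < 3 → b ≤ 3 + β → a + (b + c) ≡ 8 + (β + γ) → γ ≤ c
window-fits {a} {b} {c} {β} {γ} (s≤s a≤2) hb h = +-cancelˡ-≤ (5 + β) γ c (begin
  5 + β + γ         ≤⟨ m≤n+m (5 + β + γ) 3 ⟩
  8 + (β + γ)       ≡⟨ sym h ⟩
  a + (b + c)       ≤⟨ +-mono-≤ a≤2 (+-monoˡ-≤ c hb) ⟩
  5 + β + c         ∎)
  where open ≤-Reasoning

reduce : ∀ n a b c → a < 3 → a + (b + c) ≡ 8 + n → Reducible n ⟨ a , b , c ⟩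
reduce n a b c a<3 h with b <? 3 | b <? 4 + n
... | yes b<3 | _ = reduce-at ⟨ a , b , c ∸ n ⟩ 0 n
    (cell-≡ (+-identityʳ a) (+-identityʳ b) (m∸n+n≡m (window-fits {β = 0} a<3 (<⇒≤ b<3) h)))
    refl h a<3 (inj₂ (hi≤ b<3)) (finish b<3)
  where
  hi≤ : ∀ {b} → b < 3 → hi b ≤ 7
  hi≤ {0} _ = m≤m+n 4 3
  hi≤ {1} _ = m≤m+n 4 3
  hi≤ {2} _ = m≤m+n 4 3
  hi≤ {suc (suc (suc _))} (s≤s (s≤s (s≤s ())))
  finish : ∀ {b} → b < 3 → ∀ q → Reach (8 + n) (strip (gap (lo b + 0) (hi b + 0)) (allBut (deeper q)))
                                               (strip (λ _ → false) (allBut (deeper q)))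
  finish {0} _ q = finish-right 3 n (m≤m+n 3 (1 + n))
  finish {1} _ q = finish-right 3 n (m≤m+n 3 (1 + n))
  finish {2} _ q = finish-right 3 n (m≤m+n 3 (1 + n))
  finish {suc (suc (suc _))} (s≤s (s≤s (s≤s ())))
... | no b≮3 | yes b<4+n with β , refl ← m≤n⇒∃[o]m+o≡n (≮⇒≥ b≮3) =
    reduce-at ⟨ a , 3 , c ∸ (n ∸ β) ⟩ β (n ∸ β)
      (cell-≡ (+-identityʳ a) refl
        (m∸n+n≡m (window-fits {β = β} a<3 ≤-refl (trans h (cong (8 +_) (sym (m+[n∸m]≡n β≤n)))))))
      (m+[n∸m]≡n β≤n) h a<3 (inj₂ (m≤m+n 5 2))
      λ q → finish-left β n (n≤1+n _) (≤-trans β≤n (m≤n+m n 4)) ⨾ finish-right (4 + β) n (+-monoʳ-≤ 4 β≤n)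
  where
  β≤n : β ≤ n
  β≤n = +-cancelˡ-≤ 4 β n b<4+n
... | no _ | no b≮4+n with k , refl ← m≤n⇒∃[o]m+o≡n (≮⇒≥ b≮4+n) =
    reduce-at ⟨ a , 4 + k , c ⟩ n 0
      (cell-≡ (+-identityʳ a) (cong (4 +_) (+-comm k n)) (+-identityʳ c))
      (+-identityʳ n) h a<3 (inj₁ refl)
      λ q → finish-left (1 + n) n (m≤n+m (5 + n) 4) (m≤n+m (1 + n) 3) ⨾ done (cleared n)

-- The condition in terms of residues, and its rotation.

-- The first argument is the residue of n - 1, so `0₃` is the case n ≡ 1.
Compatible : ℤ₃ → ℤ₃ → ℤ₃ → Set
Compatible 0₃ u v = u ≢ 0₃ × u ⊹ v ≡ 0₃
Compatible 1₃ u v = u ≡ v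
Compatible 2₃ u v = u ≡ v

compatible-rot : ∀ k u v → Compatible k u v → Compatible k (k ⊹ u) (k ⊹ v)
compatible-rot 0₃ u v h = h
compatible-rot 1₃ u v refl = refl
compatible-rot 2₃ u v refl = refl

⊹-triple : ∀ u v → u ⊹ (u ⊹ (u ⊹ v)) ≡ v
⊹-triple 0₃ v = refl
⊹-triple 1₃ v = next³ v
⊹-triple 2₃ v = trans (cong (next ∘ next ∘ next) (next³ v)) (next³ v)

mod3-triple : ∀ m n → mod3 (m + (m + (m + n))) ≡ mod3 n
mod3-triple m n
  rewrite mod3-+ m (m + (m + n)) | mod3-+ m (m + n) | mod3-+ m n = ⊹-triple (mod3 m) (mod3 n)

-- The new value 2c + a differs from (a + b + c) + (2b + c) by 3b. Rotation thus permutes the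
-- residues cyclically, except for n ≡ 1, where it fixes them.
colour-rot : ∀ p → colour (rot p) ≡ mod3 (size p) ⊹ colour p
colour-rot ⟨ a , b , c ⟩ = begin
  mod3 (c + (c + a))                      ≡⟨ sym (mod3-triple b (c + (c + a))) ⟩
  mod3 (b + (b + (b + (c + (c + a)))))    ≡⟨ cong mod3 (regroup a b c) ⟩
  mod3 (a + (b + c) + (b + (b + c)))      ≡⟨ mod3-+ (a + (b + c)) (b + (b + c)) ⟩
  mod3 (a + (b + c)) ⊹ mod3 (b + (b + c)) ∎
  where
  open ≡-Reasoning
  regroup : ∀ a b c → b + (b + (b + (c + (c + a)))) ≡ a + (b + c) + (b + (b + c))
  regroup = solve-∀

AllSolvable : ℕ → Set
AllSolvable N = ∀ s f → size s ≡ N → size f ≡ N → Compatible (mod3 N) (colour s) (colour f) → Solv N s f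

colour-rot-at : ∀ {N} p → size p ≡ N → colour (rot p) ≡ mod3 N ⊹ colour p
colour-rot-at p refl = colour-rot p

compatible-rot-at : ∀ {N} s f → size s ≡ N → size f ≡ N → Compatible (mod3 N) (colour s) (colour f) →
                    Compatible (mod3 N) (colour (rot s)) (colour (rot f))
compatible-rot-at {N} s f hs hf h
  rewrite colour-rot-at s hs | colour-rot-at f hf = compatible-rot (mod3 N) (colour s) (colour f) h

-- The boards n = 6, 7, 8.

allButThese : List Cell → Pos
allButThese []       p = true
allButThese (q ∷ qs) p = not (p == q) ∧ allButThese qs p

-- Both the initial position with vacancy s and, by duality, the final one with peg f are a few jumps
-- away from a fixed position, so that one long game serves all pairs s, f.
through-hubs : ∀ {N s f H H′} → Reach N (allBut s) H → Reach N H (not ∘ H′) → Reach N (allBut f) H′ → Solv N s f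
through-hubs r r′ r″ = r ⨾ r′ ⨾ dual r″ ⨾ done λ p _ → not-involutive _

hub-check : ℕ → ℤ₃ → (Cell → List Move) → Pos → Bool
hub-check N u moves H = allPlane N λ s → not (colour s ≡₃ u) ∨ leads N (moves s) (just ∘ allBut s) (just ∘ H)

≡₃-refl : ∀ u → (u ≡₃ u) ≡ true
≡₃-refl 0₃ = refl
≡₃-refl 1₃ = refl
≡₃-refl 2₃ = refl

to-hub : ∀ {N u moves H} → hub-check N u moves H ≡ true → ∀ s → size s ≡ N → colour s ≡ u → Reach N (allBut s) H
to-hub {N} {u} {moves} {H} ok s hs refl = run-board N (moves s) (checked (allPlane-sound N _ ok s hs))
  where
  checked : not (colour s ≡₃ u) ∨ leads N (moves s) (just ∘ allBut s) (just ∘ H) ≡ true →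
            leads N (moves s) (just ∘ allBut s) (just ∘ H) ≡ true
  checked h rewrite ≡₃-refl (colour s) = h

hub₅ hub₅′ : Pos
hub₅ = allButThese
  (⟨ 4 , 0 , 1 ⟩ ∷ ⟨ 3 , 1 , 1 ⟩ ∷ ⟨ 2 , 3 , 0 ⟩ ∷ ⟨ 1 , 2 , 2 ⟩ ∷ ⟨ 1 , 3 , 1 ⟩ ∷ [])
hub₅′ = allButThese
  (⟨ 3 , 0 , 2 ⟩ ∷ ⟨ 2 , 0 , 3 ⟩ ∷ ⟨ 2 , 1 , 2 ⟩ ∷ ⟨ 2 , 2 , 1 ⟩ ∷ ⟨ 2 , 3 , 0 ⟩ ∷ ⟨ 1 , 1 , 3 ⟩ ∷ [])

toHub₅ : Cell → List Move
toHub₅ ⟨ 5 , 0 , _ ⟩ = ca 3 0 0 ∷ bc 3 0 0 ∷ ba 1 2 0 ∷ cb 1 2 0 ∷ []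
toHub₅ ⟨ 3 , 1 , _ ⟩ = ca 1 1 1 ∷ bc 2 1 0 ∷ ab 2 0 1 ∷ bc 1 1 1 ∷ []
toHub₅ ⟨ 2 , 0 , _ ⟩ = ac 2 0 1 ∷ bc 3 0 0 ∷ ba 1 2 0 ∷ cb 1 2 0 ∷ []
toHub₅ ⟨ 2 , 3 , _ ⟩ = cb 2 1 0 ∷ ab 2 0 1 ∷ ba 0 1 2 ∷ ac 0 3 0 ∷ []
toHub₅ ⟨ 1 , 2 , _ ⟩ = ac 1 2 0 ∷ ab 2 0 1 ∷ ba 1 2 0 ∷ cb 1 2 0 ∷ []
toHub₅ ⟨ 0 , 1 , _ ⟩ = ac 0 1 2 ∷ bc 2 1 0 ∷ ab 2 0 1 ∷ bc 1 1 1 ∷ []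
toHub₅ ⟨ 0 , 4 , _ ⟩ = cb 0 2 1 ∷ ac 0 2 1 ∷ ab 2 0 1 ∷ ac 0 3 0 ∷ []
toHub₅ _ = []

toHub₅′ : Cell → List Move
toHub₅′ ⟨ 5 , 0 , _ ⟩ = ca 3 0 0 ∷ ba 2 0 1 ∷ cb 2 0 1 ∷ bc 2 1 0 ∷ ca 1 1 1 ∷ []
toHub₅′ ⟨ 3 , 1 , _ ⟩ = ba 1 1 1 ∷ cb 2 0 1 ∷ bc 2 1 0 ∷ cb 1 1 1 ∷ ab 1 0 2 ∷ []
toHub₅′ ⟨ 2 , 0 , _ ⟩ = ac 2 0 1 ∷ ba 2 0 1 ∷ cb 2 0 1 ∷ bc 2 1 0 ∷ ca 1 1 1 ∷ []
toHub₅′ ⟨ 2 , 3 , _ ⟩ = cb 2 1 0 ∷ ab 2 0 1 ∷ ca 2 0 1 ∷ bc 2 1 0 ∷ ca 1 1 1 ∷ []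
toHub₅′ ⟨ 1 , 2 , _ ⟩ = ab 1 0 2 ∷ bc 2 1 0 ∷ ba 1 0 2 ∷ cb 1 0 2 ∷ ac 1 0 2 ∷ []
toHub₅′ ⟨ 0 , 1 , _ ⟩ = bc 0 1 2 ∷ ab 0 0 3 ∷ ab 0 1 2 ∷ bc 2 1 0 ∷ ab 1 0 2 ∷ []
toHub₅′ ⟨ 0 , 4 , _ ⟩ = ab 0 2 1 ∷ cb 2 0 1 ∷ bc 2 1 0 ∷ cb 1 1 1 ∷ ab 1 0 2 ∷ []
toHub₅′ _ = []

-- From sixteen pegs to six. With four jumps into `hub₅` and five reversed ones from `hub₅′` these
-- ten make up the nineteen jumps of a game on T₆.
crossing₅ : List Move
crossing₅ =
  ac 1 2 0 ∷ ab 3 0 0 ∷ cb 2 0 1 ∷ ca 0 0 3 ∷ ba 0 1 2 ∷ ba 0 3 0 ∷ cb 0 1 2 ∷ bc 0 2 1 ∷ ac 1 2 0 ∷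
  ca 0 2 1 ∷ []

hub₆ hub₆′ : Pos
hub₆ = allButThese
  (⟨ 3 , 1 , 2 ⟩ ∷ ⟨ 2 , 1 , 3 ⟩ ∷ ⟨ 2 , 3 , 1 ⟩ ∷ ⟨ 2 , 4 , 0 ⟩ ∷ ⟨ 1 , 2 , 3 ⟩ ∷ [])
hub₆′ = allButThese
  (⟨ 3 , 1 , 2 ⟩ ∷ ⟨ 3 , 2 , 1 ⟩ ∷ ⟨ 2 , 1 , 3 ⟩ ∷ ⟨ 1 , 3 , 2 ⟩ ∷ ⟨ 0 , 4 , 2 ⟩ ∷ [])

toHub₆ : Cell → List Move
toHub₆ ⟨ 5 , 0 , _ ⟩ = ba 3 0 1 ∷ ca 2 1 1 ∷ ca 1 2 1 ∷ bc 2 2 0 ∷ []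
toHub₆ ⟨ 5 , 1 , _ ⟩ = ca 3 1 0 ∷ ba 2 1 1 ∷ cb 2 1 1 ∷ ba 0 2 2 ∷ []
toHub₆ ⟨ 4 , 0 , _ ⟩ = bc 4 0 0 ∷ ca 2 1 1 ∷ ca 2 2 0 ∷ ba 0 2 2 ∷ []
toHub₆ ⟨ 4 , 2 , _ ⟩ = ba 2 2 0 ∷ ca 1 3 0 ∷ cb 1 1 2 ∷ ac 1 1 2 ∷ []
toHub₆ ⟨ 3 , 1 , _ ⟩ = ba 1 1 2 ∷ bc 2 2 0 ∷ cb 1 1 2 ∷ ac 1 1 2 ∷ []
toHub₆ ⟨ 3 , 2 , _ ⟩ = cb 3 0 1 ∷ ba 1 0 3 ∷ ac 1 2 1 ∷ ba 0 2 2 ∷ []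
toHub₆ ⟨ 2 , 0 , _ ⟩ = ac 2 0 2 ∷ ba 2 0 2 ∷ bc 2 2 0 ∷ ba 1 0 3 ∷ []
toHub₆ ⟨ 2 , 1 , _ ⟩ = ac 2 1 1 ∷ ba 2 1 1 ∷ cb 2 1 1 ∷ ba 0 2 2 ∷ []
toHub₆ ⟨ 2 , 3 , _ ⟩ = ab 2 1 1 ∷ ca 2 1 1 ∷ ca 1 2 1 ∷ bc 2 2 0 ∷ []
toHub₆ ⟨ 2 , 4 , _ ⟩ = cb 2 2 0 ∷ ab 2 1 1 ∷ ca 2 1 1 ∷ ba 0 2 2 ∷ []
toHub₆ ⟨ 1 , 0 , _ ⟩ = ac 1 0 3 ∷ bc 3 0 1 ∷ bc 2 0 2 ∷ ba 0 2 2 ∷ []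
toHub₆ ⟨ 1 , 2 , _ ⟩ = ab 1 0 3 ∷ bc 3 0 1 ∷ ca 1 2 1 ∷ bc 2 2 0 ∷ []
toHub₆ ⟨ 1 , 3 , _ ⟩ = cb 1 1 2 ∷ ac 1 1 2 ∷ ac 1 2 1 ∷ ba 0 2 2 ∷ []
toHub₆ ⟨ 1 , 5 , _ ⟩ = ab 1 3 0 ∷ ca 1 3 0 ∷ cb 1 1 2 ∷ ac 1 1 2 ∷ []
toHub₆ ⟨ 0 , 1 , _ ⟩ = ac 0 1 3 ∷ bc 1 1 2 ∷ ab 1 1 2 ∷ bc 2 2 0 ∷ []
toHub₆ ⟨ 0 , 2 , _ ⟩ = ac 0 2 2 ∷ ab 1 0 3 ∷ bc 3 0 1 ∷ ba 0 2 2 ∷ []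
toHub₆ ⟨ 0 , 4 , _ ⟩ = ab 0 2 2 ∷ bc 2 2 0 ∷ cb 1 1 2 ∷ ac 1 1 2 ∷ []
toHub₆ ⟨ 0 , 5 , _ ⟩ = cb 0 3 1 ∷ ac 0 3 1 ∷ ab 2 1 1 ∷ ca 2 1 1 ∷ []
toHub₆ _ = []

crossing₆ : List Move
crossing₆ =
  ab 2 2 0 ∷ ab 4 0 0 ∷ ba 1 1 2 ∷ ba 1 3 0 ∷ ba 3 1 0 ∷ cb 4 0 0 ∷ ca 2 0 2 ∷ ca 0 0 4 ∷ ba 0 3 1 ∷
  cb 0 3 1 ∷ bc 0 4 0 ∷ cb 0 1 3 ∷ ac 3 0 1 ∷ ac 1 0 3 ∷ cb 1 0 3 ∷ ba 0 1 3 ∷ ab 3 1 0 ∷ ac 1 3 0 ∷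
  []

hub₇ : Pos
hub₇ = allButThese
  (⟨ 5 , 0 , 2 ⟩ ∷ ⟨ 4 , 1 , 2 ⟩ ∷ ⟨ 3 , 1 , 3 ⟩ ∷ ⟨ 2 , 2 , 3 ⟩ ∷ ⟨ 1 , 3 , 3 ⟩ ∷ ⟨ 1 , 4 , 2 ⟩ ∷
   ⟨ 0 , 3 , 4 ⟩ ∷ [])

toHub₇ : Cell → List Move
toHub₇ ⟨ 7 , 0 , _ ⟩ = ca 5 0 0 ∷ ba 4 0 1 ∷ ca 3 1 1 ∷ ca 2 2 1 ∷ ba 1 2 2 ∷ ca 0 3 2 ∷ []
toHub₇ ⟨ 5 , 1 , _ ⟩ = ba 3 1 1 ∷ cb 3 1 1 ∷ ab 3 0 2 ∷ ca 2 2 1 ∷ ba 1 2 2 ∷ ca 0 3 2 ∷ []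
toHub₇ ⟨ 4 , 0 , _ ⟩ = ac 4 0 1 ∷ ba 4 0 1 ∷ ca 3 1 1 ∷ ca 2 2 1 ∷ ba 1 2 2 ∷ ca 0 3 2 ∷ []
toHub₇ ⟨ 4 , 3 , _ ⟩ = cb 4 1 0 ∷ ca 2 1 2 ∷ ca 2 2 1 ∷ ab 3 0 2 ∷ ba 0 1 4 ∷ bc 1 2 2 ∷ []
toHub₇ ⟨ 3 , 2 , _ ⟩ = ab 3 0 2 ∷ ba 2 1 2 ∷ cb 2 1 2 ∷ ac 2 1 2 ∷ ba 1 2 2 ∷ ca 0 3 2 ∷ []
toHub₇ ⟨ 2 , 1 , _ ⟩ = ac 2 1 2 ∷ ba 2 1 2 ∷ ab 3 0 2 ∷ cb 2 1 2 ∷ ba 0 1 4 ∷ bc 1 2 2 ∷ []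
toHub₇ ⟨ 2 , 4 , _ ⟩ = ab 2 2 1 ∷ cb 3 1 1 ∷ ab 3 0 2 ∷ ca 2 2 1 ∷ ba 1 2 2 ∷ ca 0 3 2 ∷ []
toHub₇ ⟨ 1 , 0 , _ ⟩ = ac 1 0 4 ∷ bc 3 0 2 ∷ ab 3 0 2 ∷ bc 2 0 3 ∷ ba 0 1 4 ∷ bc 1 2 2 ∷ []
toHub₇ ⟨ 1 , 3 , _ ⟩ = ab 1 1 3 ∷ bc 3 1 1 ∷ ab 3 0 2 ∷ cb 3 1 1 ∷ ba 1 2 2 ∷ ca 0 3 2 ∷ []
toHub₇ ⟨ 1 , 6 , _ ⟩ = cb 1 4 0 ∷ ab 1 2 2 ∷ ab 3 0 2 ∷ cb 1 3 1 ∷ ab 1 1 3 ∷ ca 0 3 2 ∷ []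
toHub₇ ⟨ 0 , 2 , _ ⟩ = ac 0 2 3 ∷ ab 1 0 4 ∷ bc 3 0 2 ∷ ab 3 0 2 ∷ ba 0 1 4 ∷ bc 1 2 2 ∷ []
toHub₇ ⟨ 0 , 5 , _ ⟩ = ab 0 3 2 ∷ ab 2 1 2 ∷ ca 2 1 2 ∷ ab 3 0 2 ∷ bc 2 1 2 ∷ ca 0 3 2 ∷ []
toHub₇ _ = []

crossing₇ : List Move
crossing₇ =
  ca 3 0 2 ∷ cb 2 0 3 ∷ ba 2 1 2 ∷ ab 3 0 2 ∷ cb 1 1 3 ∷ ac 1 2 2 ∷ ca 0 0 5 ∷ cb 0 1 4 ∷ ba 0 1 4 ∷
  cb 2 0 3 ∷ bc 0 3 2 ∷ ac 5 0 0 ∷ ac 3 2 0 ∷ ba 3 2 0 ∷ ba 1 4 0 ∷ bc 3 1 1 ∷ bc 0 5 0 ∷ ca 0 5 0 ∷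
  ba 2 3 0 ∷ ab 3 2 0 ∷ ac 1 4 0 ∷ ac 4 1 0 ∷ []

-- For n = 6 and n = 8 rotation carries every residue class to `0₃`, so only holes of this class
-- need explicit games.
Solvable₀ : ℕ → Set
Solvable₀ N = ∀ s f → size s ≡ N → size f ≡ N → colour s ≡ 0₃ → colour f ≡ 0₃ → Solv N s f

solvable-0₅ : Solvable₀ 5
solvable-0₅ s f hs hf us uf = through-hubs
  (to-hub {5} {0₃} {toHub₅} {hub₅} refl s hs us) (run-board 5 crossing₅ refl)
  (to-hub {5} {0₃} {toHub₅′} {hub₅′} refl f hf uf)

solvable-0₇ : Solvable₀ 7
solvable-0₇ s f hs hf us uf = through-hubs
  (to-hub {7} {0₃} {toHub₇} {hub₇} refl s hs us) (run-board 7 crossing₇ refl)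
  (to-hub {7} {0₃} {toHub₇} {hub₇} refl f hf uf)

rotated : ∀ {N} → Solvable₀ N → mod3 N ≢ 0₃ → ∀ s f → size s ≡ N → size f ≡ N → colour s ≡ colour f → Solv N s f
rotated {N} base N≢0 s f hs hf e = go (colour s) refl (mod3 N) refl
  where
  on-rot : ∀ {p} → size p ≡ N → size (rot p) ≡ N
  on-rot {p} h = trans (size-rot p) h
  once : ∀ {u k} → colour s ≡ u → mod3 N ≡ k → ∀ p → size p ≡ N → colour s ≡ colour p → colour (rot p) ≡ k ⊹ u
  once refl refl p h e = trans (colour-rot-at p h) (cong (mod3 N ⊹_) (sym e))
  twice : ∀ {u k} → colour s ≡ u → mod3 N ≡ k → ∀ p → size p ≡ N → colour s ≡ colour p →
          colour (rot (rot p)) ≡ k ⊹ (k ⊹ u)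
  twice eu ek p h e = trans (colour-rot-at (rot p) (on-rot {p} h)) (cong₂ _⊹_ ek (once eu ek p h e))
  one-turn : ∀ {u k} → colour s ≡ u → mod3 N ≡ k → k ⊹ u ≡ 0₃ → Solv N s f
  one-turn eu ek z = solv-rot (base (rot s) (rot f) (on-rot {s} hs) (on-rot {f} hf)
    (trans (once eu ek s hs refl) z) (trans (once eu ek f hf e) z))
  two-turns : ∀ {u k} → colour s ≡ u → mod3 N ≡ k → k ⊹ (k ⊹ u) ≡ 0₃ → Solv N s f
  two-turns eu ek z = solv-rot (solv-rot (base (rot (rot s)) (rot (rot f))
    (on-rot {rot s} (on-rot {s} hs)) (on-rot {rot f} (on-rot {f} hf))
    (trans (twice eu ek s hs refl) z) (trans (twice eu ek f hf e) z)))
  go : ∀ u → colour s ≡ u → ∀ k → mod3 N ≡ k → Solv N s f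
  go 0₃ eu k  ek = base s f hs hf eu (trans (sym e) eu)
  go u  eu 0₃ ek = contradiction ek N≢0
  go 1₃ eu 2₃ ek = one-turn eu ek refl
  go 2₃ eu 1₃ ek = one-turn eu ek refl
  go 1₃ eu 1₃ ek = two-turns eu ek refl
  go 2₃ eu 2₃ ek = two-turns eu ek refl

solvable₅ : AllSolvable 5
solvable₅ s f hs hf e = rotated solvable-0₅ (λ ()) s f hs hf e

solvable₇ : AllSolvable 7
solvable₇ s f hs hf e = rotated solvable-0₇ (λ ()) s f hs hf e

-- Rotation fixes the residues on T₇, so `1₃` and `2₃` each have their own hub; duality exchanges
-- the two orders.
solvable₆ : AllSolvable 6
solvable₆ s f hs hf (s≢0 , e) = go (colour s) refl (colour f) refl
  where
  forth : ∀ s f → size s ≡ 6 → size f ≡ 6 → colour s ≡ 1₃ → colour f ≡ 2₃ → Solv 6 s f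
  forth s f hs hf us uf = through-hubs
    (to-hub {6} {1₃} {toHub₆} {hub₆} refl s hs us) (run-board 6 crossing₆ refl)
    (to-hub {6} {2₃} {toHub₆} {hub₆′} refl f hf uf)
  sum : ∀ {u v} → colour s ≡ u → colour f ≡ v → u ⊹ v ≡ 0₃
  sum refl refl = e
  go : ∀ u → colour s ≡ u → ∀ v → colour f ≡ v → Solv 6 s f
  go 0₃ us v  uf = contradiction us s≢0
  go 1₃ us 2₃ uf = forth s f hs hf us uf
  go 2₃ us 1₃ uf = solv-dual (forth f s hf hs uf us)
  go 1₃ us 0₃ uf = contradiction (sum us uf) λ ()
  go 1₃ us 1₃ uf = contradiction (sum us uf) λ ()
  go 2₃ us 0₃ uf = contradiction (sum us uf) λ ()
  go 2₃ us 2₃ uf = contradiction (sum us uf) λ ()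

-- The induction step.

strip-allBut : ∀ {N} s → allBut (up s) ≈[ N ] strip (λ _ → true) (allBut s)
strip-allBut s ⟨ 0 , b , c ⟩ _ = refl
strip-allBut s ⟨ 1 , b , c ⟩ _ = refl
strip-allBut s ⟨ 2 , b , c ⟩ _ = refl
strip-allBut s ⟨ suc (suc (suc a)) , b , c ⟩ _ = refl

strip-only : ∀ {N} f → strip (λ _ → false) (only₁ f) ≈[ N ] only₁ (up f)
strip-only f ⟨ 0 , b , c ⟩ _ = refl
strip-only f ⟨ 1 , b , c ⟩ _ = refl
strip-only f ⟨ 2 , b , c ⟩ _ = refl
strip-only f ⟨ suc (suc (suc a)) , b , c ⟩ _ = refl

strip-not : ∀ {N} g → strip (λ _ → true) (only₁ g) ≈[ N ] (not ∘ strip (λ _ → false) (allBut g))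
strip-not g ⟨ 0 , b , c ⟩ _ = refl
strip-not g ⟨ 1 , b , c ⟩ _ = refl
strip-not g ⟨ 2 , b , c ⟩ _ = refl
strip-not g ⟨ suc (suc (suc a)) , b , c ⟩ _ = sym (not-involutive _)

only-not-full : ∀ {M} (t : Triple M) f → ¬ Constant t true (only₁ f)
only-not-full t f (e₀ , e₁ , _) = t₀≢t₁ t (trans (==-true e₀) (sym (==-true e₁)))

allBut-not-empty : ∀ {M} (t : Triple M) s → ¬ Constant t false (allBut s)
allBut-not-empty t s (e₀ , e₁ , e₂) = only-not-full t s (flip e₀ , flip e₁ , flip e₂)
  where
  flip : ∀ {u} → not u ≡ false → u ≡ true
  flip {true} _ = refl

corner : ∀ n → AllSolvable (5 + n) → ∀ s f → size s ≡ 5 + n → size f ≡ 8 + n →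
         Compatible (mod3 (5 + n)) (colour s) (colour f) → Solv (8 + n) (up s) f
corner n IH s f hs hf h with Cell.a f <? 3
corner n IH s ⟨ a , b , c ⟩ hs hf h | yes a<3
  with g , hg , eg , r ← reduce n a b c a<3 hf
  = ≈-reach (strip-allBut s) (raise-reach (IH s g hs hg (subst (Compatible (mod3 (5 + n)) (colour s)) (sym eg) h)))
  ⨾ done (strip-not g) ⨾ dual r ⨾ done λ p _ → not-involutive _
corner n IH s ⟨ suc (suc (suc a)) , b , c ⟩ hs hf h | no _ =
  ≈-reach (strip-allBut s) (clear-strip-meanwhile n (IH s f hs (suc-injective (suc-injective (suc-injective hf))) h)
    (allBut-not-empty (left n) s) (allBut-not-empty (right n) s)
    (only-not-full (left n) f) (only-not-full (right n) f))
  ⨾ done (strip-only f)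
  where f = ⟨ a , b , c ⟩
corner n IH s ⟨ 0 , b , c ⟩ hs hf h | no a≮3 = contradiction (s≤s z≤n) a≮3
corner n IH s ⟨ 1 , b , c ⟩ hs hf h | no a≮3 = contradiction (s≤s (s≤s z≤n)) a≮3
corner n IH s ⟨ 2 , b , c ⟩ hs hf h | no a≮3 = contradiction (s≤s (s≤s (s≤s z≤n))) a≮3

corner-step : ∀ n → AllSolvable (5 + n) → ∀ s f → size s ≡ 8 + n → size f ≡ 8 + n →
              Compatible (mod3 (8 + n)) (colour s) (colour f) → 3 ≤ Cell.a s → Solv (8 + n) s f
corner-step n IH ⟨ suc (suc (suc a)) , b , c ⟩ f hs hf h _ =
  corner n IH ⟨ a , b , c ⟩ f (suc-injective (suc-injective (suc-injective hs))) hf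
    (subst (λ k → Compatible k (mod3 (b + (b + c))) (colour f)) (next³ (mod3 (5 + n))) h)
corner-step n IH ⟨ 0 , b , c ⟩ f hs hf h ()
corner-step n IH ⟨ 1 , b , c ⟩ f hs hf h (s≤s ())
corner-step n IH ⟨ 2 , b , c ⟩ f hs hf h (s≤s (s≤s ()))

solvable-step : ∀ n → AllSolvable (5 + n) → AllSolvable (8 + n)
solvable-step n IH s@(⟨ a , b , c ⟩) f hs hf h with 3 ≤? a | 3 ≤? b | 3 ≤? c
... | yes a≥3 | _ | _ = corner-step n IH s f hs hf h a≥3
... | no _ | yes b≥3 | _ = solv-rot (corner-step n IH (rot s) (rot f) (trans (size-rot s) hs) (trans (size-rot f) hf)
        (compatible-rot-at s f hs hf h) b≥3)
... | no _ | no _ | yes c≥3 = solv-rot (solv-rot (corner-step n IH (rot (rot s)) (rot (rot f))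
        (trans (size-rot (rot s)) (trans (size-rot s) hs)) (trans (size-rot (rot f)) (trans (size-rot f) hf))
        (compatible-rot-at (rot s) (rot f) (trans (size-rot s) hs) (trans (size-rot f) hf)
          (compatible-rot-at s f hs hf h)) c≥3))
-- Three coordinates of at most 2 add up to at most 6, less than `8 + n`.
... | no a≱3 | no b≱3 | no c≱3 = contradiction
        (≤-trans (≤-trans (m≤m+n 8 n) (≤-reflexive (sym hs)))
          (+-mono-≤ (≤-pred (≰⇒> a≱3)) (+-mono-≤ (≤-pred (≰⇒> b≱3)) (≤-pred (≰⇒> c≱3)))))
        λ { (s≤s (s≤s (s≤s (s≤s (s≤s (s≤s ())))))) }

all-solvable : ∀ k → AllSolvable (5 + k)
all-solvable 0 = solvable₅
all-solvable 1 = solvable₆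
all-solvable 2 = solvable₇
all-solvable (suc (suc (suc k))) = solvable-step k (all-solvable k)

-- From cells back to holes, jumps and the stated condition.

toCell : ∀ {N} → Hole (suc N) → Cell
toCell {N} h = ⟨ N ∸ y h , x h , y h ∸ x h ⟩

x≤y-of : ∀ {n} (h : Hole n) → x h ≤ y h
x≤y-of (hole x y p _) = recompute (x ≤? y) p

y<n-of : ∀ {n} (h : Hole n) → y h < n
y<n-of {n} (hole _ y _ p) = recompute (y <? n) p

size-toCell : ∀ {N} (h : Hole (suc N)) → size (toCell h) ≡ N
size-toCell {N} h = trans (cong (N ∸ y h +_) (m+[n∸m]≡n (x≤y-of h))) (m∸n+n≡m (≤-pred (y<n-of h)))

fromCell : ∀ {N} p → size p ≡ N → Hole (suc N)
fromCell ⟨ a , b , c ⟩ h = hole b (b + c) (m≤m+n b c) (s≤s (≤-trans (m≤n+m (b + c) a) (≤-reflexive h)))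

toCell-fromCell : ∀ {N} p (h : size p ≡ N) → toCell (fromCell p h) ≡ p
toCell-fromCell ⟨ a , b , c ⟩ refl = cell-≡ (m+n∸n≡m a (b + c)) refl (m+n∸m≡n b c)

toCell-injective : ∀ {N} {h k : Hole (suc N)} → toCell h ≡ toCell k → h ≡ k
toCell-injective {h = h} {k} e = equal-holes (cong Cell.b e)
  (trans (sym (m∸n+n≡m (x≤y-of h))) (trans (cong₂ _+_ (cong Cell.c e) (cong Cell.b e)) (m∸n+n≡m (x≤y-of k))))
  where
  equal-holes : ∀ {n} {h k : Hole n} → x h ≡ x k → y h ≡ y k → h ≡ k
  equal-holes {h = hole _ _ _ _} {hole _ _ _ _} refl refl = refl

fromCell-toCell : ∀ {N} (h : Hole (suc N)) → fromCell (toCell h) (size-toCell h) ≡ h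
fromCell-toCell h = toCell-injective (toCell-fromCell (toCell h) (size-toCell h))

≟-toCell : ∀ {N} (h k : Hole (suc N)) → does (h ≟ k) ≡ (toCell h == toCell k)
≟-toCell h k with h ≟ k
... | yes refl = sym (==-refl (toCell h))
... | no h≢k   = sym (≢⇒==-false (h≢k ∘ toCell-injective))

content : Bool → Content
content u = if u then peg else empty

-- Since x = b and y = b + c, trading a for b raises both coordinates, trading a for c only y, and
-- trading c for b only x.
direction : Move → Direction
direction (ab _ _ _) = +xy
direction (ac _ _ _) = +y
direction (ba _ _ _) = -xy
direction (bc _ _ _) = -x
direction (ca _ _ _) = -y
direction (cb _ _ _) = +x

coordinates : Cell → ℤ × ℤ
coordinates ⟨ _ , b , c ⟩ = pos b , pos (b + c)

over-point : ∀ m → coordinates (over m) ≡ coordinates (from m) ⊕ vector (direction m)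
over-point (ab a b c) = cong₂ _,_ (cong pos (+-comm 1 b)) (cong pos (+-comm 1 (b + c)))
over-point (ac a b c) = cong₂ _,_ (cong pos (sym (+-identityʳ b))) (cong pos (trans (+-suc b c) (+-comm 1 (b + c))))
over-point (ba a b c) = refl
over-point (bc a b c) = cong (pos (1 + b) ,_) (cong pos (trans (cong suc (+-suc b c)) (sym (+-identityʳ _))))
over-point (ca a b c) rewrite +-suc b (suc c) = cong (_, pos (b + suc c)) (cong pos (sym (+-identityʳ b)))
over-point (cb a b c) = cong₂ _,_ (cong pos (+-comm 1 b))
  (cong pos (trans (sym (+-suc b (suc c))) (sym (+-identityʳ _))))

to-point : ∀ m → coordinates (to m) ≡ coordinates (over m) ⊕ vector (direction m)
to-point (ab a b c) = cong₂ _,_ (cong pos (+-comm 1 (1 + b))) (cong pos (+-comm 1 (1 + b + c)))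
to-point (ac a b c) = cong₂ _,_ (cong pos (sym (+-identityʳ b)))
  (cong pos (trans (+-suc b (suc c)) (+-comm 1 (b + suc c))))
to-point (ba a b c) = refl
to-point (bc a b c) = cong (pos b ,_) (cong pos (trans (+-suc b (suc c)) (sym (+-identityʳ _))))
to-point (ca a b c) rewrite +-suc b c = cong (_, pos (b + c)) (cong pos (sym (+-identityʳ b)))
to-point (cb a b c) = cong₂ _,_ (cong pos (+-comm 1 (1 + b)))
  (cong pos (trans (cong suc (sym (+-suc b c))) (sym (+-identityʳ _))))

realise-step : ∀ {N P Q} {A A′ : Position (suc N)} → Step N P Q →
  (∀ h → A h ≡ content (P (toCell h))) → (∀ h → A′ h ≡ content (Q (toCell h))) → Jump A A′
realise-step {N} {P} {Q} {A} {A′} s eA eA′ = record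
  { d = direction m ; p = fromCell f hf ; q = fromCell o ho ; r = fromCell t ht
  ; q≡p+d = over-point m
  ; r≡p+2d = trans (to-point m) (cong (_⊕ vector (direction m)) (over-point m))
  ; p-before = before hf (from-before s) ; q-before = before ho (over-before s) ; r-before = before ht (to-before s)
  ; p-after = after hf (from-after s) ; q-after = after ho (over-after s) ; r-after = after ht (to-after s)
  ; unchanged = λ h u v w → trans (eA′ h) (trans
      (cong content (unchanged s (toCell h) (size-toCell h) (elsewhere hf u) (elsewhere ho v) (elsewhere ht w)))
      (sym (eA h))) }
  where
  m = move s
  f = from m
  o = over m
  t = to m
  hf = on-board s
  ho = over-on-board s
  ht = to-on-board s
  before : ∀ {p u} (hp : size p ≡ N) → P p ≡ u → A (fromCell p hp) ≡ content u
  before {p} hp e = trans (eA _) (cong content (trans (cong P (toCell-fromCell p hp)) e))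
  after : ∀ {p u} (hp : size p ≡ N) → Q p ≡ u → A′ (fromCell p hp) ≡ content u
  after {p} hp e = trans (eA′ _) (cong content (trans (cong Q (toCell-fromCell p hp)) e))
  elsewhere : ∀ {h p} (hp : size p ≡ N) → h ≢ fromCell p hp → toCell h ≢ p
  elsewhere {h} {p} hp h≢ e = h≢ (toCell-injective (trans e (sym (toCell-fromCell p hp))))

realise : ∀ {N P Q} {A : Position (suc N)} → Reach N P Q → (∀ h → A h ≡ content (P (toCell h))) →
          ∃[ A′ ] Star Jump A A′ × (∀ h → A′ h ≡ content (Q (toCell h)))
realise {A = A} (done e) eA = A , ε , λ h → trans (eA h) (cong content (e (toCell h) (size-toCell h)))
realise (_then_ {Q = Q} s r) eA with A′ , js , eA′ ← realise {A = content ∘ Q ∘ toCell} r (λ _ → refl) =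
  A′ , realise-step s eA (λ _ → refl) ◅ js , eA′

allExcept-toCell : ∀ {N} (s h : Hole (suc N)) → allExcept s h ≡ content (allBut (toCell s) (toCell h))
allExcept-toCell s h rewrite ≟-toCell h s with toCell h == toCell s
... | true  = refl
... | false = refl

only-toCell : ∀ {N} (f h : Hole (suc N)) → only f h ≡ content (only₁ (toCell f) (toCell h))
only-toCell f h = cong content (≟-toCell h f)

solv⇒Solvable : ∀ {N} (s f : Hole (suc N)) → Solv N (toCell s) (toCell f) → Solvable s f
solv⇒Solvable s f r with A , js , eA ← realise r (allExcept-toCell s) =
  A , js , λ h → trans (eA h) (sym (only-toCell f h))

residue : ℤ₃ → ℕ
residue 0₃ = 0
residue 1₃ = 1
residue 2₃ = 2

residue-injective : ∀ {u v} → residue u ≡ residue v → u ≡ v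
residue-injective {0₃} {0₃} _ = refl
residue-injective {1₃} {1₃} _ = refl
residue-injective {2₃} {2₃} _ = refl

residue-mod3 : ∀ n → residue (mod3 n) ≡ n % 3
residue-mod3 0 = refl
residue-mod3 1 = refl
residue-mod3 2 = refl
residue-mod3 (suc (suc (suc n))) = trans (cong residue (next³ (mod3 n)))
  (trans (residue-mod3 n) (sym (trans (cong (_% 3) (+-comm 3 n)) ([m+n]%n≡m%n n 3))))

colour-toCell : ∀ {N} (h : Hole (suc N)) → colour (toCell h) ≡ mod3 (x h + y h)
colour-toCell h = cong (λ k → mod3 (x h + k)) (m+[n∸m]≡n (x≤y-of h))

module _ {N : ℕ} (s f : Hole (suc N)) where
  private
    u = colour (toCell s)
    v = colour (toCell f)

    residue-s : residue u ≡ (x s + y s) % 3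
    residue-s = trans (cong residue (colour-toCell s)) (residue-mod3 (x s + y s))

    residue-f : residue v ≡ (x f + y f) % 3
    residue-f = trans (cong residue (colour-toCell f)) (residue-mod3 (x f + y f))

    residue-sum : residue (u ⊹ v) ≡ (x s + y s + x f + y f) % 3
    residue-sum = begin
      residue (u ⊹ v)                           ≡⟨ cong₂ (λ i j → residue (i ⊹ j)) (colour-toCell s) (colour-toCell f) ⟩
      residue (mod3 (x s + y s) ⊹ mod3 (x f + y f)) ≡⟨ cong residue (sym (mod3-+ (x s + y s) (x f + y f))) ⟩
      residue (mod3 (x s + y s + (x f + y f)))  ≡⟨ residue-mod3 (x s + y s + (x f + y f)) ⟩
      (x s + y s + (x f + y f)) % 3             ≡⟨ cong (_% 3) (sym (+-assoc (x s + y s) (x f) (y f))) ⟩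
      (x s + y s + x f + y f) % 3               ∎
      where open ≡-Reasoning

    residue-n : residue (next (mod3 N)) ≡ suc N % 3
    residue-n = residue-mod3 (suc N)

  condition⇒compatible : Condition s f → Compatible (mod3 N) u v
  condition⇒compatible (c₁ , c₂) = go (mod3 N) residue-n
    where
    go : ∀ k → residue (next k) ≡ suc N % 3 → Compatible k u v
    go 0₃ e with ne , z ← c₁ (sym e) =
      (λ u≡0 → ne (trans (sym residue-s) (cong residue u≡0))) , residue-injective (trans residue-sum z)
    go 1₃ e = residue-injective (trans residue-s (trans (c₂ λ e′ → contradiction (trans e e′) λ ()) (sym residue-f)))
    go 2₃ e = residue-injective (trans residue-s (trans (c₂ λ e′ → contradiction (trans e e′) λ ()) (sym residue-f)))

  compatible⇒condition : Compatible (mod3 N) u v → Condition s f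
  compatible⇒condition = go (mod3 N) residue-n
    where
    same-residue : u ≡ v → (x s + y s) % 3 ≡ (x f + y f) % 3
    same-residue e = trans (sym residue-s) (trans (cong residue e) residue-f)
    go : ∀ k → residue (next k) ≡ suc N % 3 → Compatible k u v → Condition s f
    go 0₃ e (ne , z) =
      (λ _ → (λ e′ → ne (residue-injective (trans residue-s e′))) , trans (sym residue-sum) (cong residue z))
      , λ n≢1 → contradiction (sym e) n≢1
    go 1₃ e uv = (λ e′ → contradiction (trans e e′) λ ()) , λ _ → same-residue uv
    go 2₃ e uv = (λ e′ → contradiction (trans e e′) λ ()) , λ _ → same-residue uv

-- Necessity: sums in 𝔽₂ over a board.

Σ⊕ : ℕ → (ℕ → ℕ → Bool) → Bool
Σ⊕ zero    f = f 0 0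
Σ⊕ (suc K) f = f 0 (suc K) xor Σ⊕ K λ i j → f (suc i) j

Σ⊕-cong : ∀ K {f g} → (∀ i j → i + j ≡ K → f i j ≡ g i j) → Σ⊕ K f ≡ Σ⊕ K g
Σ⊕-cong zero    e = e 0 0 refl
Σ⊕-cong (suc K) e = cong₂ _xor_ (e 0 (suc K) refl) (Σ⊕-cong K λ i j h → e (suc i) j (cong suc h))

xor-interchange : ∀ t u v w → (t xor u) xor (v xor w) ≡ (t xor v) xor (u xor w)
xor-interchange false false v     w = refl
xor-interchange false true  false w = refl
xor-interchange false true  true  w = refl
xor-interchange true  false false w = refl
xor-interchange true  false true  w = not-involutive w
xor-interchange true  true  false w = sym (not-involutive w)
xor-interchange true  true  true  w = refl

Σ⊕-xor : ∀ K f g → Σ⊕ K (λ i j → f i j xor g i j) ≡ Σ⊕ K f xor Σ⊕ K g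
Σ⊕-xor zero    f g = refl
Σ⊕-xor (suc K) f g = trans (cong ((f 0 (suc K) xor g 0 (suc K)) xor_) (Σ⊕-xor K (λ i → f (suc i)) (λ i → g (suc i))))
  (xor-interchange (f 0 (suc K)) (g 0 (suc K)) _ _)

Σ⊕-zero : ∀ K {f} → (∀ i j → i + j ≡ K → f i j ≡ false) → Σ⊕ K f ≡ false
Σ⊕-zero zero    e = e 0 0 refl
Σ⊕-zero (suc K) e = cong₂ _xor_ (e 0 (suc K) refl) (Σ⊕-zero K λ i j h → e (suc i) j (cong suc h))

Σ⊕-point : ∀ K {f} i j → i + j ≡ K → (∀ i′ j′ → i′ + j′ ≡ K → i′ ≢ i → f i′ j′ ≡ false) → Σ⊕ K f ≡ f i j
Σ⊕-point zero    zero    .zero    refl z = refl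
Σ⊕-point (suc K) {f} zero .(suc K) refl z =
  trans (cong (f 0 (suc K) xor_) (Σ⊕-zero K λ i j h → z (suc i) j (cong suc h) λ ())) (xor-identityʳ _)
Σ⊕-point (suc K) (suc i) j h z = cong₂ _xor_ (z 0 (suc K) refl λ ())
  (Σ⊕-point K i j (suc-injective h) λ i′ j′ h′ i′≢i → z (suc i′) j′ (cong suc h′) (i′≢i ∘ suc-injective))

plane⊕ : ℕ → Pos → Bool
plane⊕ N F = Σ⊕ N λ a m → Σ⊕ m λ b c → F ⟨ a , b , c ⟩

plane⊕-cong : ∀ N {F G} → F ≈[ N ] G → plane⊕ N F ≡ plane⊕ N G
plane⊕-cong N e = Σ⊕-cong N λ a m h → Σ⊕-cong m λ b c h′ →
  e ⟨ a , b , c ⟩ (trans (cong (a +_) h′) h)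

plane⊕-xor : ∀ N F G → plane⊕ N (λ p → F p xor G p) ≡ plane⊕ N F xor plane⊕ N G
plane⊕-xor N F G = trans (Σ⊕-cong N λ a m _ → Σ⊕-xor m (λ b c → F ⟨ a , b , c ⟩) (λ b c → G ⟨ a , b , c ⟩))
  (Σ⊕-xor N (λ a m → Σ⊕ m λ b c → F ⟨ a , b , c ⟩) (λ a m → Σ⊕ m λ b c → G ⟨ a , b , c ⟩))

plane⊕-point : ∀ {N} p (G : Pos) → size p ≡ N → plane⊕ N (λ q → (q == p) ∧ G q) ≡ G p
plane⊕-point {N} p@(⟨ a , b , c ⟩) G h = begin
  plane⊕ N (λ q → (q == p) ∧ G q)
    ≡⟨ Σ⊕-point N a (b + c) h (λ a′ m _ a′≢a → Σ⊕-zero m λ b′ c′ _ → off ⟨ a′ , b′ , c′ ⟩ (a′≢a ∘ cong Cell.a)) ⟩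
  Σ⊕ (b + c) (λ b′ c′ → (⟨ a , b′ , c′ ⟩ == p) ∧ G ⟨ a , b′ , c′ ⟩)
    ≡⟨ Σ⊕-point (b + c) b c refl (λ b′ c′ _ b′≢b → off ⟨ a , b′ , c′ ⟩ (b′≢b ∘ cong Cell.b)) ⟩
  (p == p) ∧ G p
    ≡⟨ cong (_∧ G p) (==-refl p) ⟩
  G p ∎
  where
  open ≡-Reasoning
  off : ∀ q → q ≢ p → (q == p) ∧ G q ≡ false
  off q q≢p rewrite ≢⇒==-false q≢p = refl

-- χ k ∘ colour is a weighting of the holes by 𝔽₂ that sums to zero over the three holes of any jump.
χ : ℤ₃ → ℤ₃ → Bool
χ k u = not (u ≡₃ k)

χ-balanced : ∀ k u → χ k u xor (χ k (next u) xor χ k (next (next u))) ≡ false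
χ-balanced 0₃ 0₃ = refl
χ-balanced 0₃ 1₃ = refl
χ-balanced 0₃ 2₃ = refl
χ-balanced 1₃ 0₃ = refl
χ-balanced 1₃ 1₃ = refl
χ-balanced 1₃ 2₃ = refl
χ-balanced 2₃ 0₃ = refl
χ-balanced 2₃ 1₃ = refl
χ-balanced 2₃ 2₃ = refl

χ-balanced′ : ∀ k u → χ k u xor (χ k (next (next u)) xor χ k (next (next (next (next u))))) ≡ false
χ-balanced′ 0₃ 0₃ = refl
χ-balanced′ 0₃ 1₃ = refl
χ-balanced′ 0₃ 2₃ = refl
χ-balanced′ 1₃ 0₃ = refl
χ-balanced′ 1₃ 1₃ = refl
χ-balanced′ 1₃ 2₃ = refl
χ-balanced′ 2₃ 0₃ = refl
χ-balanced′ 2₃ 1₃ = refl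
χ-balanced′ 2₃ 2₃ = refl

module FullBoard (k : ℤ₃) where

  -- The weight of `m + 1` holes whose residues go up by one from `u`; on the board the row y = m
  -- starts at `mod3 m`.
  row : ℕ → ℤ₃ → Bool
  row m u = Σ⊕ m λ b _ → χ k (mod3 b ⊹ u)

  ⊹-next : ∀ u v → u ⊹ next v ≡ next u ⊹ v
  ⊹-next 0₃ v = refl
  ⊹-next 1₃ v = refl
  ⊹-next 2₃ v = next³ v

  row-suc : ∀ m u → row (suc m) u ≡ χ k u xor row m (next u)
  row-suc m u = cong (χ k u xor_) (Σ⊕-cong m λ b _ _ → cong (χ k) (sym (⊹-next (mod3 b) u)))

  row-3 : ∀ m u → row (3 + m) u ≡ row m u
  row-3 m u = begin
    row (3 + m) u
      ≡⟨ trans (row-suc (2 + m) u) (cong (χ k u xor_)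
           (trans (row-suc (1 + m) (next u)) (cong (χ k (next u) xor_) (row-suc m (next (next u)))))) ⟩
    χ k u xor (χ k (next u) xor (χ k (next (next u)) xor row m (next (next (next u)))))
      ≡⟨ cong (χ k u xor_) (sym (xor-assoc (χ k (next u)) _ _)) ⟩
    χ k u xor ((χ k (next u) xor χ k (next (next u))) xor row m (next (next (next u))))
      ≡⟨ sym (xor-assoc (χ k u) _ _) ⟩
    (χ k u xor (χ k (next u) xor χ k (next (next u)))) xor row m (next (next (next u)))
      ≡⟨ cong₂ _xor_ (χ-balanced k u) (cong (row m) (next³ u)) ⟩
    row m u ∎
    where open ≡-Reasoning

  -- Three consecutive holes cancel, so only m modulo 3 matters. The rows m = 0, 1, 2 have the
  -- residues 0, then 1 and 2, then all three; as all three cancel, 1 and 2 together weigh as much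
  -- as 0.
  rowTotal : ℤ₃ → Bool
  rowTotal 0₃ = χ k 0₃
  rowTotal 1₃ = χ k 0₃
  rowTotal 2₃ = false

  row-total : ∀ m → row m (mod3 m) ≡ rowTotal (mod3 m)
  row-total 0 = refl
  row-total 1 = base k
    where
    base : ∀ k → χ k 1₃ xor χ k 2₃ ≡ χ k 0₃
    base 0₃ = refl
    base 1₃ = refl
    base 2₃ = refl
  row-total 2 = χ-balanced k 2₃
  row-total (suc (suc (suc m))) rewrite next³ (mod3 m) = trans (row-3 m (mod3 m)) (row-total m)

  -- With t the weight of residue 0, the row totals t, t, 0 repeat and have the partial sums t, 0,
  -- 0. A full board therefore contributes only for n ≡ 1, which is where the two cases of the
  -- theorem part.
  boardTotal : ℤ₃ → Bool
  boardTotal 0₃ = χ k 0₃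
  boardTotal 1₃ = false
  boardTotal 2₃ = false

  full-total : ∀ N → plane⊕ N (χ k ∘ colour) ≡ boardTotal (mod3 N)
  full-total N = trans (Σ⊕-cong N λ _ m _ → as-row m) (sum-rows N)
    where
    as-row : ∀ m → Σ⊕ m (λ b c → χ k (mod3 (b + (b + c)))) ≡ rowTotal (mod3 m)
    as-row m = trans (Σ⊕-cong m λ b c h → cong (χ k) (trans (mod3-+ b (b + c)) (cong (λ i → mod3 b ⊹ mod3 i) h)))
      (row-total m)
    add-row : ∀ u → rowTotal (next u) xor boardTotal u ≡ boardTotal (next u)
    add-row 0₃ = xor-same (χ k 0₃)
    add-row 1₃ = refl
    add-row 2₃ = xor-identityʳ (χ k 0₃)
    sum-rows : ∀ N → Σ⊕ N (λ _ m → rowTotal (mod3 m)) ≡ boardTotal (mod3 N)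
    sum-rows zero    = refl
    sum-rows (suc N) = trans (cong (rowTotal (mod3 (suc N)) xor_) (sum-rows N)) (add-row (mod3 N))

open FullBoard using (boardTotal; full-total)

-- Necessity: invariance of the charge.

isPeg : Content → Bool
isPeg peg   = true
isPeg empty = false

isPeg-content : ∀ u → isPeg (content u) ≡ u
isPeg-content true  = refl
isPeg-content false = refl

-- The sums need a function on all cells. Testing b + c suffices, because a is determined by b and c
-- on the plane.
pegAt : ∀ {N} → Position (suc N) → Pos
pegAt {N} A ⟨ a , b , c ⟩ with b + c <? suc N
... | yes h = isPeg (A (hole b (b + c) (m≤m+n b c) h))
... | no _  = false

pegAt-fromCell : ∀ {N} (A : Position (suc N)) p (h : size p ≡ N) → pegAt A p ≡ isPeg (A (fromCell p h))
pegAt-fromCell {N} A ⟨ a , b , c ⟩ h with b + c <? suc N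
... | yes _ = refl
... | no ≮  = contradiction (s≤s (≤-trans (m≤n+m (b + c) a) (≤-reflexive h))) ≮

pegAt-≈ : ∀ {N} {A : Position (suc N)} {P : Pos} → (∀ h → isPeg (A h) ≡ P (toCell h)) → pegAt A ≈[ N ] P
pegAt-≈ {A = A} {P} e p h = trans (pegAt-fromCell A p h) (trans (e _) (cong P (toCell-fromCell p h)))

charge : ∀ {N} → ℤ₃ → Position (suc N) → Bool
charge {N} k A = plane⊕ N λ p → pegAt A p ∧ χ k (colour p)

charge-≈ : ∀ {N k} {A : Position (suc N)} {P : Pos} → (∀ h → isPeg (A h) ≡ P (toCell h)) →
           charge k A ≡ plane⊕ N λ p → P p ∧ χ k (colour p)
charge-≈ {N} {k} {A} {P} e = plane⊕-cong N λ p h → cong (_∧ χ k (colour p)) (pegAt-≈ {A = A} {P} e p h)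

charge-only : ∀ {N k} {A : Position (suc N)} f → (∀ h → A h ≡ only f h) → charge k A ≡ χ k (colour (toCell f))
charge-only {k = k} f e = trans
  (charge-≈ {P = only₁ (toCell f)} λ h → trans (cong isPeg (trans (e h) (only-toCell f h))) (isPeg-content _))
  (plane⊕-point (toCell f) (χ k ∘ colour) (size-toCell f))

charge-allExcept : ∀ {N k} (s : Hole (suc N)) →
                   charge k (allExcept s) ≡ boardTotal k (mod3 N) xor χ k (colour (toCell s))
charge-allExcept {N} {k} s = begin
  charge k (allExcept s)
    ≡⟨ charge-≈ {P = allBut ŝ} (λ h → trans (cong isPeg (allExcept-toCell s h)) (isPeg-content _)) ⟩
  plane⊕ N (λ p → not (p == ŝ) ∧ χ k (colour p))
    ≡⟨ plane⊕-cong N (λ p _ → complement (p == ŝ) (χ k (colour p))) ⟩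
  plane⊕ N (λ p → χ k (colour p) xor ((p == ŝ) ∧ χ k (colour p)))
    ≡⟨ plane⊕-xor N (χ k ∘ colour) (λ p → (p == ŝ) ∧ χ k (colour p)) ⟩
  plane⊕ N (χ k ∘ colour) xor plane⊕ N (λ p → (p == ŝ) ∧ χ k (colour p))
    ≡⟨ cong₂ _xor_ (full-total k N) (plane⊕-point ŝ (χ k ∘ colour) (size-toCell s)) ⟩
  boardTotal k (mod3 N) xor χ k (colour ŝ) ∎
  where
  open ≡-Reasoning
  ŝ = toCell s
  complement : ∀ u v → not u ∧ v ≡ v xor (u ∧ v)
  complement true  v = sym (xor-same v)
  complement false v = sym (xor-identityʳ v)

-- The change of x + y modulo 3.
turn : Direction → ℤ₃
turn +x  = 1₃
turn -x  = 2₃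
turn +y  = 1₃
turn -y  = 2₃
turn +xy = 2₃
turn -xy = 1₃

plus-one : ∀ {i j} → pos i ≡ pos j ℤ.+ 1ℤ → i ≡ suc j
plus-one {j = j} e = trans (pos-injective e) (+-comm j 1)

plus-zero : ∀ {i j} → pos i ≡ pos j ℤ.+ 0ℤ → i ≡ j
plus-zero {j = j} e = trans (pos-injective e) (+-identityʳ j)

minus-one : ∀ {i j} → pos i ≡ pos j ℤ.+ -1ℤ → j ≡ suc i
minus-one {j = zero}  ()
minus-one {j = suc j} e = cong suc (sym (pos-injective e))

turn-colour : ∀ {n} d {p q : Hole n} → point q ≡ point p ⊕ vector d → mod3 (x q + y q) ≡ turn d ⊹ mod3 (x p + y p)
turn-colour +x {p} e rewrite plus-one (cong proj₁ e) | plus-zero (cong proj₂ e) = refl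
turn-colour -x {p} {q} e rewrite minus-one {j = x p} (cong proj₁ e) | plus-zero (cong proj₂ e) = sym (next³ _)
turn-colour +y {p} e rewrite plus-zero (cong proj₁ e) | plus-one (cong proj₂ e) | +-suc (x p) (y p) = refl
turn-colour -y {p} {q} e rewrite plus-zero (cong proj₁ e) | minus-one {j = y p} (cong proj₂ e) | +-suc (x p) (y q) =
  sym (next³ _)
turn-colour +xy {p} e rewrite plus-one (cong proj₁ e) | plus-one (cong proj₂ e) | +-suc (x p) (y p) = refl
turn-colour -xy {p} {q} e
  rewrite minus-one {j = x p} (cong proj₁ e) | minus-one {j = y p} (cong proj₂ e) | +-suc (x q) (y q) = sym (next³ _)

turn-balanced : ∀ d k u → χ k u xor (χ k (turn d ⊹ u) xor χ k (turn d ⊹ (turn d ⊹ u))) ≡ false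
turn-balanced +x  = χ-balanced
turn-balanced -x  = χ-balanced′
turn-balanced +y  = χ-balanced
turn-balanced -y  = χ-balanced′
turn-balanced +xy = χ-balanced′
turn-balanced -xy = χ-balanced

next-≢ : ∀ u → next u ≢ u
next-≢ 0₃ ()
next-≢ 1₃ ()
next-≢ 2₃ ()

next²-≢ : ∀ u → next (next u) ≢ u
next²-≢ u e = next-≢ u (trans (cong next (sym e)) (next³ u))

turn-≢ : ∀ d u → turn d ⊹ u ≢ u
turn-≢ +x  = next-≢
turn-≢ -x  = next²-≢
turn-≢ +y  = next-≢
turn-≢ -y  = next²-≢
turn-≢ +xy = next²-≢
turn-≢ -xy = next-≢

-- A jump toggles exactly its three holes, so the charge changes by the sum of their weights, which
-- vanishes.
charge-jump : ∀ {N k} {A A′ : Position (suc N)} → Jump A A′ → charge k A′ ≡ charge k A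
charge-jump {N} {k} {A} {A′} j = begin
  charge k A′
    ≡⟨ charge-≈ {P = λ c → pegAt A c xor δ c} toggled ⟩
  plane⊕ N (λ c → (pegAt A c xor δ c) ∧ w c)
    ≡⟨ plane⊕-cong N (λ c _ → trans (∧-distribʳ-xor (w c) (pegAt A c) (δ c)) (cong (pegAt A c ∧ w c xor_)
         (trans (∧-distribʳ-xor (w c) (c == p̂) ((c == q̂) xor (c == r̂))) (cong ((c == p̂) ∧ w c xor_)
           (∧-distribʳ-xor (w c) (c == q̂) (c == r̂)))))) ⟩
  plane⊕ N (λ c → (pegAt A c ∧ w c) xor (((c == p̂) ∧ w c) xor (((c == q̂) ∧ w c) xor ((c == r̂) ∧ w c))))
    ≡⟨ trans (plane⊕-xor N _ _) (cong (charge k A xor_) (trans (plane⊕-xor N _ _)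
         (cong₂ _xor_ (plane⊕-point p̂ w (size-toCell p)) (trans (plane⊕-xor N _ _)
           (cong₂ _xor_ (plane⊕-point q̂ w (size-toCell q)) (plane⊕-point r̂ w (size-toCell r))))))) ⟩
  charge k A xor (w p̂ xor (w q̂ xor w r̂))
    ≡⟨ cong (charge k A xor_) balanced ⟩
  charge k A xor false
    ≡⟨ xor-identityʳ _ ⟩
  charge k A ∎
  where
  open ≡-Reasoning
  open Jump j hiding (unchanged)
  p̂ = toCell p
  q̂ = toCell q
  r̂ = toCell r
  w δ : Pos
  w c = χ k (colour c)
  δ c = (c == p̂) xor ((c == q̂) xor (c == r̂))
  colour-q : colour q̂ ≡ turn d ⊹ colour p̂
  colour-q = trans (colour-toCell q) (trans (turn-colour d {p} {q} q≡p+d) (cong (turn d ⊹_) (sym (colour-toCell p))))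
  colour-r : colour r̂ ≡ turn d ⊹ colour q̂
  colour-r = trans (colour-toCell r) (trans
    (turn-colour d {q} {r} (trans r≡p+2d (cong (_⊕ vector d) (sym q≡p+d)))) (cong (turn d ⊹_) (sym (colour-toCell q))))
  balanced : w p̂ xor (w q̂ xor w r̂) ≡ false
  balanced rewrite colour-r | colour-q = turn-balanced d k (colour p̂)
  -- The indicator functions in `δ` must not overlap: adjacent holes differ in residue, the two
  -- outer ones in content.
  q̂≢p̂ : q̂ ≢ p̂
  q̂≢p̂ e = turn-≢ d (colour p̂) (trans (sym colour-q) (cong colour e))
  r̂≢q̂ : r̂ ≢ q̂
  r̂≢q̂ e = turn-≢ d (colour q̂) (trans (sym colour-r) (cong colour e))
  r̂≢p̂ : r̂ ≢ p̂
  r̂≢p̂ e with refl ← toCell-injective {h = r} {p} e = contradiction (trans (sym p-before) r-before) λ ()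
  pegAt-toCell : ∀ h → pegAt A (toCell h) ≡ isPeg (A h)
  pegAt-toCell h = trans (pegAt-fromCell A (toCell h) (size-toCell h)) (cong (isPeg ∘ A) (fromCell-toCell h))
  toggled : ∀ h → isPeg (A′ h) ≡ pegAt A (toCell h) xor δ (toCell h)
  toggled h rewrite pegAt-toCell h with h ≟ p | h ≟ q | h ≟ r
  ... | yes refl | _ | _
    rewrite ==-refl p̂ | ≢⇒==-false (q̂≢p̂ ∘ sym) | ≢⇒==-false (r̂≢p̂ ∘ sym) | p-before | p-after = refl
  ... | no _ | yes refl | _
    rewrite ≢⇒==-false q̂≢p̂ | ==-refl q̂ | ≢⇒==-false (r̂≢q̂ ∘ sym) | q-before | q-after = refl
  ... | no _ | no _ | yes refl
    rewrite ≢⇒==-false r̂≢p̂ | ≢⇒==-false r̂≢q̂ | ==-refl r̂ | r-before | r-after = refl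
  ... | no h≢p | no h≢q | no h≢r
    rewrite ≢⇒==-false (h≢p ∘ toCell-injective) | ≢⇒==-false (h≢q ∘ toCell-injective)
      | ≢⇒==-false (h≢r ∘ toCell-injective) | Jump.unchanged j h h≢p h≢q h≢r = sym (xor-identityʳ _)

charge-star : ∀ {N k} {A A′ : Position (suc N)} → Star Jump A A′ → charge k A′ ≡ charge k A
charge-star ε        = refl
charge-star (j ◅ js) = trans (charge-star js) (charge-jump j)

-- `χ v` vanishes only at `v`, so the choice k = `v` decides.
χ-separates : ∀ u v → (∀ k → χ k v ≡ χ k u) → u ≡ v
χ-separates u v e = ≡₃-true u v (trans (sym (not-involutive _))
  (trans (cong not (sym (e v))) (trans (not-involutive _) (≡₃-refl v))))

-- As k varies, the weights of the residues are the three nonzero vectors of a plane over 𝔽₂, any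
-- two adding up to the third. When the full board contributes the weight of 0, u = 0 would require
-- a zero vector, and u = 1 or 2 leaves v = 2 or 1.
charges⇒compatible : ∀ m u v → (∀ k → χ k v ≡ boardTotal k m xor χ k u) → Compatible m u v
charges⇒compatible 0₃ 0₃ 0₃ e = contradiction (e 1₃) λ ()
charges⇒compatible 0₃ 0₃ 1₃ e = contradiction (e 0₃) λ ()
charges⇒compatible 0₃ 0₃ 2₃ e = contradiction (e 0₃) λ ()
charges⇒compatible 0₃ 1₃ 0₃ e = contradiction (e 0₃) λ ()
charges⇒compatible 0₃ 1₃ 1₃ e = contradiction (e 1₃) λ ()
charges⇒compatible 0₃ 1₃ 2₃ e = (λ ()) , refl
charges⇒compatible 0₃ 2₃ 0₃ e = contradiction (e 0₃) λ ()
charges⇒compatible 0₃ 2₃ 1₃ e = (λ ()) , refl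
charges⇒compatible 0₃ 2₃ 2₃ e = contradiction (e 2₃) λ ()
charges⇒compatible 1₃ u v e = χ-separates u v e
charges⇒compatible 2₃ u v e = χ-separates u v e

solvable⇒compatible : ∀ {N} (s f : Hole (suc N)) → Solvable s f →
                      Compatible (mod3 N) (colour (toCell s)) (colour (toCell f))
solvable⇒compatible {N} s f (A , js , e) = charges⇒compatible (mod3 N) _ _ λ k →
  trans (sym (charge-only {k = k} f e)) (trans (charge-star js) (charge-allExcept s))

theorem2p2 : ∀ (n : ℕ) → n ≥ 1 → (s f : Hole n) →
    (Solvable s f → Condition s f) × (n ≥ 6 → Condition s f → Solvable s f)
theorem2p2 (suc N) _ s f = compatible⇒condition s f ∘ solvable⇒compatible s f , sufficient
  where
  sufficient : suc N ≥ 6 → Condition s f → Solvable s f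
  sufficient (s≤s N≥5) cond with k , refl ← m≤n⇒∃[o]m+o≡n N≥5 = solv⇒Solvable s f
    (all-solvable k (toCell s) (toCell f) (size-toCell s) (size-toCell f) (condition⇒compatible s f cond))
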